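{- Let $k\ge 3$ be an integer and let $X=\mathbb{B}_k$ be the $k$-book graph. Then the algebraic connectivity of the line graph $L(X)$ is $$a(L(X))=\frac{4+k-\sqrt{k^2+8}}{2}.$$
   Context: All graphs are finite and simple. The Laplacian matrix of a graph is its diagonal degree matrix minus its adjacency matrix; the algebraic connectivity $a(Y)$ of a graph $Y$ is the second smallest eigenvalue (counted with multiplicity) of its Laplacian matrix. $L(X)$ is the line graph of $X$. The $k$-book graph $\mathbb{B}_k$ is the Cartesian product $K_{1,k}\,\Box\,K_2$ of the star $K_{1,k}$ (with $k$ pendant vertices) and the complete graph $K_2$, where in $X_1\Box X_2$ the vertices $(x_1,x_2)$ and $(x_1',x_2')$ are adjacent iff either $x_1=x_1'$ and $x_2$ is adjacent to $x_2'$ in $X_2$, or $x_2=x_2'$ and $x_1$ is adjacent to $x_1'$ in $X_1$. -}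

module Defs where

open import Level using (0ℓ)
open import Algebra.Bundles using (CommutativeRing)
open import Data.Bool.Base using (if_then_else_)
open import Data.Empty using (⊥-elim)
open import Data.Fin.Base as Fin using (Fin; remQuot)
import Data.Fin.Properties as Fin
open import Data.Integer.Base using (+_)
open import Data.List.Base using (List; length; filter; allFin; cartesianProduct; lookup)
open import Data.Nat.Base as ℕ using (ℕ; zero; suc)
import Data.Nat.Properties as ℕ
open import Data.Nat.Tactic.RingSolver using (solve-∀)
open import Data.Product using (∃; ∃-syntax; _×_; _,_; proj₁; proj₂)
open import Data.Rational.Base as ℚ using (ℚ; 0ℚ; 1ℚ; ½; ∣_∣)
import Data.Rational.Properties as ℚ
import Data.Rational.Unnormalised.Base as ℚᵘ
import Data.Rational.Unnormalised.Properties as ℚᵘ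
import Data.Rational.Solver as ℚSolver
import Data.Integer.Base as ℤ
import Data.Integer.Properties as ℤ
open import Data.Sum.Base as Sum using (_⊎_; inj₁; inj₂)
open import Data.Vec.Functional using (Vector)
open import Relation.Binary.Core using (Rel)
open import Relation.Binary.Definitions using (Decidable; Symmetric)
open import Relation.Binary.PropositionalEquality
  using (_≡_; _≢_; refl; sym; trans; cong; cong₂; subst; subst₂)
open import Relation.Nullary using (¬_; does; yes; no)
open import Relation.Nullary.Decidable using (_×-dec_; _⊎-dec_; ¬?)

------------------------------------------------------------------------
-- Real numbers: Cauchy sequences of rationals, up to null sequences

Cauchy : (ℕ → ℚ) → Set
Cauchy x = ∀ ε → 0ℚ ℚ.< ε →
  ∃[ N ] (∀ m n → N ℕ.≤ m → N ℕ.≤ n → ∣ x m ℚ.- x n ∣ ℚ.< ε)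

-- Without η, and with operations defined by copatterns, conversion checking of
-- reals compares operations by name instead of unfolding their Cauchy proofs.
record ℝ : Set where
  no-eta-equality
  field
    seq    : ℕ → ℚ
    cauchy : Cauchy seq

open ℝ public

infix 4 _≈_ _≉_ _<_ _≤_

record _≈_ (x y : ℝ) : Set where
  constructor close
  field
    closeness : ∀ ε → 0ℚ ℚ.< ε →
      ∃[ N ] (∀ n → N ℕ.≤ n → ∣ seq x n ℚ.- seq y n ∣ ℚ.< ε)

open _≈_ public

_≉_ : ℝ → ℝ → Set
x ≉ y = ¬ (x ≈ y)

record _<_ (x y : ℝ) : Set where
  constructor below
  field
    gap      : ℚ
    gap>0    : 0ℚ ℚ.< gap
    from     : ℕ
    gap-holds : ∀ n → from ℕ.≤ n → seq x n ℚ.+ gap ℚ.≤ seq y n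

open _<_ public

_≤_ : ℝ → ℝ → Set
x ≤ y = ¬ (y < x)

private
  open ℚSolver.+-*-Solver

  half>0 : ∀ {ε} → 0ℚ ℚ.< ε → 0ℚ ℚ.< ½ ℚ.* ε
  half>0 {ε} ε>0 = ℚ.positive⁻¹ _ {{ℚ.pos*pos⇒pos ½ ε {{ℚ.positive ε>0}}}}

  halves : ∀ ε → ½ ℚ.* ε ℚ.+ ½ ℚ.* ε ≡ ε
  halves = solve 1 (λ e → con ½ :* e :+ con ½ :* e := e) refl

  abs-≤ : ∀ {p q r} → p ≡ q → ∣ p ∣ ℚ.≤ r → ∣ q ∣ ℚ.≤ r
  abs-≤ {r = r} eq = subst (λ d → ∣ d ∣ ℚ.≤ r) eq

  distance-refl : ∀ p {ε} → 0ℚ ℚ.< ε → ∣ p ℚ.- p ∣ ℚ.< ε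
  distance-refl p = subst (λ d → ∣ d ∣ ℚ.< _) (sym (ℚ.+-inverseʳ p))

  distance-sym : ∀ p q → ∣ p ℚ.- q ∣ ≡ ∣ q ℚ.- p ∣
  distance-sym p q = trans
    (cong ∣_∣ (solve 2 (λ p q → p :- q := :- (q :- p)) refl p q))
    (ℚ.∣-p∣≡∣p∣ (q ℚ.- p))

  add-< : ∀ {p q r ε} → ∣ r ∣ ℚ.≤ p ℚ.+ q →
    p ℚ.< ½ ℚ.* ε → q ℚ.< ½ ℚ.* ε → ∣ r ∣ ℚ.< ε
  add-< {ε = ε} r≤ p< q< = ℚ.≤-<-trans r≤
    (subst (_ ℚ.<_) (halves ε) (ℚ.+-mono-< p< q<))

  distance-triangle : ∀ p q r →
    ∣ p ℚ.- r ∣ ℚ.≤ ∣ p ℚ.- q ∣ ℚ.+ ∣ q ℚ.- r ∣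
  distance-triangle p q r = abs-≤
    (solve 3 (λ p q r → (p :- q) :+ (q :- r) := p :- r) refl p q r)
    (ℚ.∣p+q∣≤∣p∣+∣q∣ (p ℚ.- q) (q ℚ.- r))

  distance-+ : ∀ p p′ q q′ →
    ∣ (p ℚ.+ q) ℚ.- (p′ ℚ.+ q′) ∣ ℚ.≤ ∣ p ℚ.- p′ ∣ ℚ.+ ∣ q ℚ.- q′ ∣
  distance-+ p p′ q q′ = abs-≤
    (solve 4 (λ p p′ q q′ → (p :- p′) :+ (q :- q′) := (p :+ q) :- (p′ :+ q′))
      refl p p′ q q′)
    (ℚ.∣p+q∣≤∣p∣+∣q∣ (p ℚ.- p′) (q ℚ.- q′))

  distance-neg : ∀ p q → ∣ (ℚ.- p) ℚ.- (ℚ.- q) ∣ ≡ ∣ p ℚ.- q ∣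
  distance-neg p q = trans
    (cong ∣_∣ (solve 2 (λ p q → (:- p) :- (:- q) := :- (p :- q)) refl p q))
    (ℚ.∣-p∣≡∣p∣ (p ℚ.- q))

  distance-* : ∀ p p′ q q′ →
    ∣ p ℚ.* q ℚ.- p′ ℚ.* q′ ∣ ℚ.≤
    ∣ p ∣ ℚ.* ∣ q ℚ.- q′ ∣ ℚ.+ ∣ q′ ∣ ℚ.* ∣ p ℚ.- p′ ∣
  distance-* p p′ q q′ = subst₂ ℚ._≤_
    (cong ∣_∣ (solve 4
      (λ p p′ q q′ → p :* (q :- q′) :+ q′ :* (p :- p′) := p :* q :- p′ :* q′)
      refl p p′ q q′))
    (cong₂ ℚ._+_ (ℚ.∣p*q∣≡∣p∣*∣q∣ p (q ℚ.- q′)) (ℚ.∣p*q∣≡∣p∣*∣q∣ q′ (p ℚ.- p′)))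
    (ℚ.∣p+q∣≤∣p∣+∣q∣ (p ℚ.* (q ℚ.- q′)) (q′ ℚ.* (p ℚ.- p′)))

  quotient : ∀ {b ε} → 0ℚ ℚ.< b → 0ℚ ℚ.< ε → ∃[ δ ] (0ℚ ℚ.< δ × b ℚ.* δ ≡ ε)
  quotient {b} {ε} b>0 ε>0 =
      b⁻¹ ℚ.* ε
    , ℚ.positive⁻¹ _
        {{ℚ.pos*pos⇒pos b⁻¹ {{ℚ.1/pos⇒pos b {{b⁺}}}} ε {{ℚ.positive ε>0}}}}
    , trans (sym (ℚ.*-assoc b b⁻¹ ε))
        (trans (cong (ℚ._* ε) (ℚ.*-inverseʳ b {{b≠0}})) (ℚ.*-identityˡ ε))
    where
    b⁺ : ℚ.Positive b
    b⁺ = ℚ.positive b>0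

    b≠0 : ℚ.NonZero b
    b≠0 = ℚ.pos⇒nonZero b {{b⁺}}

    b⁻¹ : ℚ
    b⁻¹ = ℚ.1/_ b {{b≠0}}

  scale-< : ∀ {b d p ε} → 0ℚ ℚ.< b → ∣ p ∣ ℚ.≤ b → b ℚ.* d ≡ ε →
    ∀ q → ∣ q ∣ ℚ.< d → ∣ p ∣ ℚ.* ∣ q ∣ ℚ.< ε
  scale-< {b} b>0 p≤b bd≡ε q q<d = ℚ.≤-<-trans
    (ℚ.*-monoʳ-≤-nonNeg ∣ q ∣ {{ℚ.∣-∣-nonNeg q}} p≤b)
    (subst (_ ℚ.<_) bd≡ε (ℚ.*-monoʳ-<-pos b {{ℚ.positive b>0}} q<d))

  bounded : ∀ x → ∃[ b ] (0ℚ ℚ.< b ×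
    ∃[ N ] (∀ n → N ℕ.≤ n → ∣ seq x n ∣ ℚ.≤ b))
  bounded x with cauchy x 1ℚ (ℚ.positive⁻¹ 1ℚ)
  ... | N , near = ∣ seq x N ∣ ℚ.+ 1ℚ
    , ℚ.positive⁻¹ _
        {{ℚ.nonNeg+pos⇒pos ∣ seq x N ∣ {{ℚ.∣-∣-nonNeg (seq x N)}} 1ℚ}}
    , N
    , λ n N≤n → ℚ.≤-trans
        (abs-≤
          (solve 2 (λ p q → p :+ (q :- p) := q) refl (seq x N) (seq x n))
          (ℚ.∣p+q∣≤∣p∣+∣q∣ (seq x N) (seq x n ℚ.- seq x N)))
        (ℚ.+-monoʳ-≤ ∣ seq x N ∣ (ℚ.<⇒≤ (near n N N≤n ℕ.≤-refl)))

  ⊔-≤ˡ : ∀ {a b n} → a ℕ.⊔ b ℕ.≤ n → a ℕ.≤ n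
  ⊔-≤ˡ {a} {b} = ℕ.≤-trans (ℕ.m≤m⊔n a b)

  ⊔-≤ʳ : ∀ {a b n} → a ℕ.⊔ b ℕ.≤ n → b ℕ.≤ n
  ⊔-≤ʳ {a} {b} = ℕ.≤-trans (ℕ.m≤n⊔m a b)

fromℚ : ℚ → ℝ
seq    (fromℚ p) _ = p
cauchy (fromℚ p) _ ε>0 = 0 , λ _ _ _ _ → distance-refl p ε>0

fromℕ : ℕ → ℝ
fromℕ n = fromℚ (+ n ℚ./ 1)

0ℝ 1ℝ : ℝ
0ℝ = fromℚ 0ℚ
1ℝ = fromℚ 1ℚ

infixl 6 _+_ _-_
infixl 7 _*_
infix  8 -_

_+_ : ℝ → ℝ → ℝ
seq    (x + y) n = seq x n ℚ.+ seq y n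
cauchy (x + y) ε ε>0 =
  let M , near-x = cauchy x (½ ℚ.* ε) (half>0 ε>0)
      N , near-y = cauchy y (½ ℚ.* ε) (half>0 ε>0)
  in M ℕ.⊔ N , λ m n m≥ n≥ →
    add-< (distance-+ (seq x m) (seq x n) (seq y m) (seq y n))
      (near-x m n (⊔-≤ˡ m≥) (⊔-≤ˡ n≥))
      (near-y m n (⊔-≤ʳ {M} m≥) (⊔-≤ʳ {M} n≥))

-_ : ℝ → ℝ
seq    (- x) n = ℚ.- seq x n
cauchy (- x) ε ε>0 =
  let N , near = cauchy x ε ε>0
  in N , λ m n m≥ n≥ →
    subst (ℚ._< ε) (sym (distance-neg (seq x m) (seq x n))) (near m n m≥ n≥)

_-_ : ℝ → ℝ → ℝ
x - y = x + (- y)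

_*_ : ℝ → ℝ → ℝ
seq    (x * y) n = seq x n ℚ.* seq y n
cauchy (x * y) ε ε>0 =
  let a , a>0 , K , x≤a = bounded x
      b , b>0 , L , y≤b = bounded y
      α , α>0 , aα = quotient a>0 (half>0 ε>0)
      β , β>0 , bβ = quotient b>0 (half>0 ε>0)
      M , near-x = cauchy x β β>0
      N , near-y = cauchy y α α>0
  in (K ℕ.⊔ L) ℕ.⊔ (M ℕ.⊔ N) , λ m n m≥ n≥ →
    add-< (distance-* (seq x m) (seq x n) (seq y m) (seq y n))
      (scale-< a>0 (x≤a m (⊔-≤ˡ (⊔-≤ˡ {K ℕ.⊔ L} m≥))) aα (seq y m ℚ.- seq y n)
        (near-y m n (⊔-≤ʳ {M} (⊔-≤ʳ {K ℕ.⊔ L} m≥)) (⊔-≤ʳ {M} (⊔-≤ʳ {K ℕ.⊔ L} n≥))))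
      (scale-< b>0 (y≤b n (⊔-≤ʳ {K} (⊔-≤ˡ {K ℕ.⊔ L} n≥))) bβ (seq x m ℚ.- seq x n)
        (near-x m n (⊔-≤ˡ (⊔-≤ʳ {K ℕ.⊔ L} m≥)) (⊔-≤ˡ (⊔-≤ʳ {K ℕ.⊔ L} n≥))))

pointwise : ∀ {x y} → (∀ n → seq x n ≡ seq y n) → x ≈ y
pointwise {x} eq = close λ ε ε>0 → 0 , λ n _ →
  subst (λ q → ∣ seq x n ℚ.- q ∣ ℚ.< ε) (eq n) (distance-refl (seq x n) ε>0)

≈-refl : ∀ {x} → x ≈ x
≈-refl = pointwise λ _ → refl

≈-sym : ∀ {x y} → x ≈ y → y ≈ x
≈-sym {x} {y} x≈y = close λ ε ε>0 →
  let N , near = closeness x≈y ε ε>0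
  in N , λ n n≥ →
    subst (ℚ._< ε) (distance-sym (seq x n) (seq y n)) (near n n≥)

≈-trans : ∀ {x y z} → x ≈ y → y ≈ z → x ≈ z
≈-trans {x} {y} {z} x≈y y≈z = close λ ε ε>0 →
  let M , near-x = closeness x≈y (½ ℚ.* ε) (half>0 ε>0)
      N , near-y = closeness y≈z (½ ℚ.* ε) (half>0 ε>0)
  in M ℕ.⊔ N , λ n n≥ →
    add-< (distance-triangle (seq x n) (seq y n) (seq z n))
      (near-x n (⊔-≤ˡ n≥)) (near-y n (⊔-≤ʳ {M} n≥))

+-cong : ∀ {x x′ y y′} → x ≈ x′ → y ≈ y′ → x + y ≈ x′ + y′
+-cong {x} {x′} {y} {y′} x≈x′ y≈y′ = close λ ε ε>0 →
  let M , near-x = closeness x≈x′ (½ ℚ.* ε) (half>0 ε>0)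
      N , near-y = closeness y≈y′ (½ ℚ.* ε) (half>0 ε>0)
  in M ℕ.⊔ N , λ n n≥ →
    add-< (distance-+ (seq x n) (seq x′ n) (seq y n) (seq y′ n))
      (near-x n (⊔-≤ˡ n≥)) (near-y n (⊔-≤ʳ {M} n≥))

-‿cong : ∀ {x y} → x ≈ y → - x ≈ - y
-‿cong {x} {y} x≈y = close λ ε ε>0 →
  let N , near = closeness x≈y ε ε>0
  in N , λ n n≥ →
    subst (ℚ._< ε) (sym (distance-neg (seq x n) (seq y n))) (near n n≥)

*-cong : ∀ {x x′ y y′} → x ≈ x′ → y ≈ y′ → x * y ≈ x′ * y′
*-cong {x} {x′} {y} {y′} x≈x′ y≈y′ = close λ ε ε>0 →
  let a , a>0 , K , x≤a = bounded x
      b , b>0 , L , y≤b = bounded y′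
      α , α>0 , aα = quotient a>0 (half>0 ε>0)
      β , β>0 , bβ = quotient b>0 (half>0 ε>0)
      M , near-x = closeness x≈x′ β β>0
      N , near-y = closeness y≈y′ α α>0
  in (K ℕ.⊔ L) ℕ.⊔ (M ℕ.⊔ N) , λ n n≥ →
    add-< (distance-* (seq x n) (seq x′ n) (seq y n) (seq y′ n))
      (scale-< a>0 (x≤a n (⊔-≤ˡ (⊔-≤ˡ {K ℕ.⊔ L} n≥))) aα (seq y n ℚ.- seq y′ n)
        (near-y n (⊔-≤ʳ {M} (⊔-≤ʳ {K ℕ.⊔ L} n≥))))
      (scale-< b>0 (y≤b n (⊔-≤ʳ {K} (⊔-≤ˡ {K ℕ.⊔ L} n≥))) bβ (seq x n ℚ.- seq x′ n)
        (near-x n (⊔-≤ˡ (⊔-≤ʳ {K ℕ.⊔ L} n≥))))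

open import Algebra.Definitions _≈_

+-assoc : Associative _+_
+-assoc x y z = pointwise λ n → ℚ.+-assoc (seq x n) (seq y n) (seq z n)

+-comm : Commutative _+_
+-comm x y = pointwise λ n → ℚ.+-comm (seq x n) (seq y n)

+-identityˡ : LeftIdentity 0ℝ _+_
+-identityˡ x = pointwise λ n → ℚ.+-identityˡ (seq x n)

+-identityʳ : RightIdentity 0ℝ _+_
+-identityʳ x = pointwise λ n → ℚ.+-identityʳ (seq x n)

+-inverseˡ : LeftInverse 0ℝ -_ _+_
+-inverseˡ x = pointwise λ n → ℚ.+-inverseˡ (seq x n)

+-inverseʳ : RightInverse 0ℝ -_ _+_
+-inverseʳ x = pointwise λ n → ℚ.+-inverseʳ (seq x n)

*-assoc : Associative _*_
*-assoc x y z = pointwise λ n → ℚ.*-assoc (seq x n) (seq y n) (seq z n)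

*-comm : Commutative _*_
*-comm x y = pointwise λ n → ℚ.*-comm (seq x n) (seq y n)

*-identityˡ : LeftIdentity 1ℝ _*_
*-identityˡ x = pointwise λ n → ℚ.*-identityˡ (seq x n)

*-identityʳ : RightIdentity 1ℝ _*_
*-identityʳ x = pointwise λ n → ℚ.*-identityʳ (seq x n)

*-distribˡ-+ : _*_ DistributesOverˡ _+_
*-distribˡ-+ x y z = pointwise λ n → ℚ.*-distribˡ-+ (seq x n) (seq y n) (seq z n)

*-distribʳ-+ : _*_ DistributesOverʳ _+_
*-distribʳ-+ x y z = pointwise λ n → ℚ.*-distribʳ-+ (seq x n) (seq y n) (seq z n)

+-*-commutativeRing : CommutativeRing 0ℓ 0ℓ
+-*-commutativeRing = record
  { Carrier = ℝ ; _≈_ = _≈_ ; _+_ = _+_ ; _*_ = _*_ ; -_ = -_ ; 0# = 0ℝ ; 1# = 1ℝ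
  ; isCommutativeRing = record
    { isRing = record
      { +-isAbelianGroup = record
        { isGroup = record
          { isMonoid = record
            { isSemigroup = record
              { isMagma = record
                { isEquivalence = record
                  { refl = ≈-refl ; sym = ≈-sym ; trans = ≈-trans }
                ; ∙-cong = +-cong
                }
              ; assoc = +-assoc
              }
            ; identity = +-identityˡ , +-identityʳ
            }
          ; inverse = +-inverseˡ , +-inverseʳ
          ; ⁻¹-cong = -‿cong
          }
        ; comm = +-comm
        }
      ; *-cong = *-cong
      ; *-assoc = *-assoc
      ; *-identity = *-identityˡ , *-identityʳ
      ; distrib = *-distribˡ-+ , *-distribʳ-+
      }
    ; *-comm = *-comm
    }
  }

------------------------------------------------------------------------
-- Square roots of natural numbers

increaseRoot : ℕ → ℕ → ℕ
increaseRoot n r with suc r ℕ.* suc r ℕ.≤? n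
... | yes _ = suc r
... | no  _ = r

-- ⌊√ n ⌋
isqrt : ℕ → ℕ
isqrt zero    = zero
isqrt (suc n) = increaseRoot (suc n) (isqrt n)

isqrt-lower : ∀ n → isqrt n ℕ.* isqrt n ℕ.≤ n
isqrt-lower zero    = ℕ.z≤n
isqrt-lower (suc n) with suc (isqrt n) ℕ.* suc (isqrt n) ℕ.≤? suc n
... | yes fits = fits
... | no  _    = ℕ.m≤n⇒m≤1+n (isqrt-lower n)

isqrt-upper : ∀ n → n ℕ.< suc (isqrt n) ℕ.* suc (isqrt n)
isqrt-upper zero    = ℕ.s≤s ℕ.z≤n
isqrt-upper (suc n) with suc (isqrt n) ℕ.* suc (isqrt n) ℕ.≤? suc n
... | yes _    = ℕ.≤-<-trans (isqrt-upper n)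
                   (ℕ.*-mono-< (ℕ.n<1+n (suc (isqrt n))) (ℕ.n<1+n (suc (isqrt n))))
... | no  over = ℕ.≰⇒> over

-- ⌊√ (a d²) ⌋ / d with d = n + 1
√-approx : ℕ → ℕ → ℚ
√-approx a n = + isqrt (a ℕ.* (suc n ℕ.* suc n)) ℚ./ suc n

private
  toℚᵘ-/ : ∀ a n → ℚ.toℚᵘ (+ a ℚ./ suc n) ℚᵘ.≃ ℚᵘ.mkℚᵘ (+ a) n
  toℚᵘ-/ a n = ℚ.toℚᵘ-fromℚᵘ (ℚᵘ.mkℚᵘ (+ a) n)

  /-< : ∀ {a b m n} → a ℕ.* suc n ℕ.< b ℕ.* suc m →
    + a ℚ./ suc m ℚ.< + b ℚ./ suc n
  /-< {a} {b} {m} {n} an<bm = ℚ.toℚᵘ-cancel-<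
    (ℚᵘ.<-respˡ-≃ (ℚᵘ.≃-sym (toℚᵘ-/ a m))
      (ℚᵘ.<-respʳ-≃ (ℚᵘ.≃-sym (toℚᵘ-/ b n))
        (ℚᵘ.*<* (subst₂ ℤ._<_ (ℤ.pos-* a (suc n)) (ℤ.pos-* b (suc m))
          (ℤ.+<+ an<bm)))))

  suc-/ : ∀ a n → + suc a ℚ./ suc n ≡ + a ℚ./ suc n ℚ.+ + 1 ℚ./ suc n
  suc-/ a n = ℚ.toℚᵘ-injective
    (ℚᵘ.≃-trans (toℚᵘ-/ (suc a) n)
      (ℚᵘ.≃-sym
        (ℚᵘ.≃-trans (ℚ.toℚᵘ-homo-+ (+ a ℚ./ suc n) (+ 1 ℚ./ suc n))
          (ℚᵘ.≃-trans (ℚᵘ.+-cong (toℚᵘ-/ a n) (toℚᵘ-/ 1 n))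
            (ℚᵘ.*≡* (trans
              (cong (λ i → (i ℤ.+ + 1 ℤ.* + suc n) ℤ.* + suc n)
                (sym (ℤ.pos-* a (suc n))))
              (trans
                (sym (ℤ.pos-* (a ℕ.* suc n ℕ.+ 1 ℕ.* suc n) (suc n)))
                (trans (cong +_ (rearranged a n))
                  (ℤ.pos-* (suc a) (suc n ℕ.* suc n))))))))))
    where
    rearranged : ∀ a n → (a ℕ.* suc n ℕ.+ 1 ℕ.* suc n) ℕ.* suc n
                       ≡ suc a ℕ.* (suc n ℕ.* suc n)
    rearranged = solve-∀

  archimedean : ∀ ε → 0ℚ ℚ.< ε → ∃[ N ] (∀ n → N ℕ.≤ n → + 1 ℚ./ suc n ℚ.< ε)
  archimedean ε@(ℚ.mkℚ (+ suc a) d-1 _) _ = suc d-1 , λ n N≤n →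
    subst (+ 1 ℚ./ suc n ℚ.<_) (ℚ.↥p/↧p≡p ε)
      (/-< {1} {suc a} {n} {d-1}
        (ℕ.<-≤-trans (ℕ.s≤s (ℕ.≤-trans (ℕ.≤-reflexive (ℕ.*-identityˡ (suc d-1))) N≤n))
          (ℕ.m≤m+n (suc n) (a ℕ.* suc n))))
  archimedean (ℚ.mkℚ (+ zero) _ _) (ℚ.*<* (ℤ.+<+ ()))
  archimedean (ℚ.mkℚ (ℤ.-[1+ _ ]) _ _) (ℚ.*<* ())

  distance-< : ∀ {p q e} → p ℚ.< q ℚ.+ e → q ℚ.< p ℚ.+ e → ∣ p ℚ.- q ∣ ℚ.< e
  distance-< {p} {q} {e} p< q< with ℚ.∣p∣≡p∨∣p∣≡-p (p ℚ.- q)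
  ... | inj₁ eq = subst₂ ℚ._<_ (sym eq)
    (solve 2 (λ q e → (q :+ e) :- q := e) refl q e)
    (ℚ.+-monoˡ-< (ℚ.- q) p<)
  ... | inj₂ eq = subst₂ ℚ._<_
    (trans (solve 2 (λ p q → q :- p := :- (p :- q)) refl p q) (sym eq))
    (solve 2 (λ p e → (p :+ e) :- p := e) refl p e)
    (ℚ.+-monoˡ-< (ℚ.- p) q<)

  √-approx-< : ∀ a m n → √-approx a m ℚ.< √-approx a n ℚ.+ + 1 ℚ./ suc n
  √-approx-< a m n = subst (√-approx a m ℚ.<_) (suc-/ s n)
    (/-< {r} {suc s} {m} {n} (ℕ.≰⇒> λ over → ℕ.<-irrefl refl (begin-strict
      a ℕ.* (suc m ℕ.* suc m) ℕ.* (suc n ℕ.* suc n)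
        ≡⟨ swap a (suc m) (suc n) ⟩
      a ℕ.* (suc n ℕ.* suc n) ℕ.* (suc m ℕ.* suc m)
        <⟨ ℕ.*-monoˡ-< (suc m ℕ.* suc m) (isqrt-upper (a ℕ.* (suc n ℕ.* suc n))) ⟩
      suc s ℕ.* suc s ℕ.* (suc m ℕ.* suc m)
        ≡⟨ squares (suc s) (suc m) ⟩
      suc s ℕ.* suc m ℕ.* (suc s ℕ.* suc m)
        ≤⟨ ℕ.*-mono-≤ over over ⟩
      r ℕ.* suc n ℕ.* (r ℕ.* suc n)
        ≡⟨ squares r (suc n) ⟨
      r ℕ.* r ℕ.* (suc n ℕ.* suc n)
        ≤⟨ ℕ.*-monoˡ-≤ (suc n ℕ.* suc n) (isqrt-lower (a ℕ.* (suc m ℕ.* suc m))) ⟩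
      a ℕ.* (suc m ℕ.* suc m) ℕ.* (suc n ℕ.* suc n) ∎)))
    where
    open ℕ.≤-Reasoning

    r s : ℕ
    r = isqrt (a ℕ.* (suc m ℕ.* suc m))
    s = isqrt (a ℕ.* (suc n ℕ.* suc n))

    swap : ∀ a x y → a ℕ.* (x ℕ.* x) ℕ.* (y ℕ.* y) ≡ a ℕ.* (y ℕ.* y) ℕ.* (x ℕ.* x)
    swap = solve-∀

    squares : ∀ x y → x ℕ.* x ℕ.* (y ℕ.* y) ≡ x ℕ.* y ℕ.* (x ℕ.* y)
    squares = solve-∀

√ : ℕ → ℝ
seq    (√ a) n = √-approx a n
cauchy (√ a) ε ε>0 =
  let N , small = archimedean ε ε>0
  in N , λ m n m≥ n≥ → distance-<
    (ℚ.<-trans (√-approx-< a m n) (ℚ.+-monoʳ-< (√-approx a n) (small n n≥)))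
    (ℚ.<-trans (√-approx-< a n m) (ℚ.+-monoʳ-< (√-approx a m) (small m m≥)))

------------------------------------------------------------------------
-- Eigenvalues and their multiplicities

open CommutativeRing +-*-commutativeRing public
  using (setoid; +-commutativeMonoid)
open import Algebra.Properties.CommutativeMonoid.Sum +-commutativeMonoid public
  using (sum)
open import Data.Vec.Functional.Relation.Binary.Equality.Setoid setoid public
  using (_≋_)

Matrix : ℕ → Set
Matrix n = Fin n → Fin n → ℝ

0ᵥ : ∀ {n} → Vector ℝ n
0ᵥ _ = 0ℝ

infixr 7 _·_ _*ᵥ_

_·_ : ∀ {n} → ℝ → Vector ℝ n → Vector ℝ n
(c · v) i = c * v i

_*ᵥ_ : ∀ {n} → Matrix n → Vector ℝ n → Vector ℝ n
(M *ᵥ v) i = sum λ j → M i j * v j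

linearCombination : ∀ {m n} → Vector ℝ m → Vector (Vector ℝ n) m → Vector ℝ n
linearCombination c b i = sum λ j → c j * b j i

InEigenspace : ∀ {n} → Matrix n → ℝ → Vector ℝ n → Set
InEigenspace M μ v = M *ᵥ v ≋ μ · v

Eigenvalue : ∀ {n} → Matrix n → ℝ → Set
Eigenvalue M μ = ∃[ v ] (¬ (v ≋ 0ᵥ) × InEigenspace M μ v)

-- The multiplicity of μ is the dimension of its eigenspace; for the symmetric
-- matrices considered here this is also its multiplicity as a root of the
-- characteristic polynomial.
record Multiplicity {n} (M : Matrix n) (μ : ℝ) (m : ℕ) : Set where
  field
    basis       : Vector (Vector ℝ n) m
    eigenvector : ∀ i → InEigenspace M μ (basis i)
    independent : ∀ c → linearCombination c basis ≋ 0ᵥ → ∀ i → c i ≈ 0ℝ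
    spanning    : ∀ v → InEigenspace M μ v → ∃[ c ] (v ≋ linearCombination c basis)

Least : (ℝ → Set) → ℝ → Set
Least P x = P x × (∀ y → P y → x ≤ y)

-- In the list of all eigenvalues in increasing order, each repeated according
-- to its multiplicity, the second entry is the least eigenvalue if that has
-- multiplicity at least two, and otherwise the least of the remaining ones.
data SecondSmallestEigenvalue {n} (M : Matrix n) (x : ℝ) : Set where
  repeated : ∀ {m} → Least (Eigenvalue M) x → Multiplicity M x m → 2 ℕ.≤ m →
             SecondSmallestEigenvalue M x
  simple   : ∀ {μ} → Least (Eigenvalue M) μ → Multiplicity M μ 1 →
             Least (λ ν → Eigenvalue M ν × ν ≉ μ) x →
             SecondSmallestEigenvalue M x

------------------------------------------------------------------------
-- Graphs

record Graph (n : ℕ) : Set₁ where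
  infix 4 _~_ _~?_
  field
    _~_      : Rel (Fin n) 0ℓ
    _~?_     : Decidable _~_
    ~-sym    : Symmetric _~_
    ~-irrefl : ∀ {i} → ¬ (i ~ i)

module _ {n} (G : Graph n) where
  open Graph G

  degree : Fin n → ℕ
  degree i = length (filter (i ~?_) (allFin n))

  degreeMatrix : Matrix n
  degreeMatrix i j = if does (i Fin.≟ j) then fromℕ (degree i) else 0ℝ

  adjacencyMatrix : Matrix n
  adjacencyMatrix i j = if does (i ~? j) then 1ℝ else 0ℝ

  laplacian : Matrix n
  laplacian i j = degreeMatrix i j - adjacencyMatrix i j

  AlgebraicConnectivity : ℝ → Set
  AlgebraicConnectivity = SecondSmallestEigenvalue laplacian

  -- Each edge is listed once, with its smaller endpoint first.
  edges : List (Fin n × Fin n)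
  edges = filter (λ (i , j) → (i Fin.<? j) ×-dec (i ~? j))
                 (cartesianProduct (allFin n) (allFin n))

_∈ₑ_ : ∀ {n} → Fin n → Fin n × Fin n → Set
v ∈ₑ (i , j) = v ≡ i ⊎ v ≡ j

_∈ₑ?_ : ∀ {n} → Decidable (_∈ₑ_ {n})
v ∈ₑ? (i , j) = (v Fin.≟ i) ⊎-dec (v Fin.≟ j)

lineGraph : ∀ {n} (G : Graph n) → Graph (length (edges G))
lineGraph G = record
  { _~_      = λ e f → e ≢ f × ∃[ v ] (v ∈ₑ edge e × v ∈ₑ edge f)
  ; _~?_     = λ e f → ¬? (e Fin.≟ f) ×-dec
                       Fin.any? λ v → (v ∈ₑ? edge e) ×-dec (v ∈ₑ? edge f)
  ; ~-sym    = λ (e≢f , v , v∈e , v∈f) → (λ f≡e → e≢f (sym f≡e)) , v , v∈f , v∈e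
  ; ~-irrefl = λ (e≢e , _) → e≢e refl
  }
  where
  edge = lookup (edges G)

complete : ∀ n → Graph n
complete n = record
  { _~_      = _≢_
  ; _~?_     = λ i j → ¬? (i Fin.≟ j)
  ; ~-sym    = λ i≢j j≡i → i≢j (sym j≡i)
  ; ~-irrefl = λ i≢i → i≢i refl
  }

-- K₁,ₖ, with centre zero
star : ∀ k → Graph (suc k)
star k = record
  { _~_      = λ i j → (i ≡ centre × j ≢ centre) ⊎ (i ≢ centre × j ≡ centre)
  ; _~?_     = λ i j → ((i Fin.≟ centre) ×-dec ¬? (j Fin.≟ centre)) ⊎-dec
                       (¬? (i Fin.≟ centre) ×-dec (j Fin.≟ centre))
  ; ~-sym    = λ { (inj₁ (i≡c , j≢c)) → inj₂ (j≢c , i≡c)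
                 ; (inj₂ (i≢c , j≡c)) → inj₁ (j≡c , i≢c) }
  ; ~-irrefl = λ { (inj₁ (i≡c , i≢c)) → i≢c i≡c
                 ; (inj₂ (i≢c , i≡c)) → i≢c i≡c }
  }
  where
  centre : Fin (suc k)
  centre = Fin.zero

-- remQuot n identifies Fin (m ℕ.* n) with Fin m × Fin n.
infixr 7 _□_

_□_ : ∀ {m n} → Graph m → Graph n → Graph (m ℕ.* n)
_□_ {m} {n} G H = record
  { _~_      = λ p q → remQuot n p ~□ remQuot n q
  ; _~?_     = λ p q → let (x , y) = remQuot {m} n p; (x′ , y′) = remQuot {m} n q in
                       ((x Fin.≟ x′) ×-dec (y H.~? y′)) ⊎-dec
                       ((y Fin.≟ y′) ×-dec (x G.~? x′))
  ; ~-sym    = Sum.map (λ (eq , adj) → sym eq , H.~-sym adj)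
                       (λ (eq , adj) → sym eq , G.~-sym adj)
  ; ~-irrefl = λ { (inj₁ (_ , adj)) → H.~-irrefl adj
                 ; (inj₂ (_ , adj)) → G.~-irrefl adj }
  }
  where
  module G = Graph G
  module H = Graph H

  _~□_ : Rel (Fin m × Fin n) 0ℓ
  (x , y) ~□ (x′ , y′) = (x ≡ x′ × y H.~ y′) ⊎ (y ≡ y′ × x G.~ x′)

book : ∀ k → Graph (suc k ℕ.* 2)
book k = star k □ complete 2

{-# OPTIONS --safe #-}

-- The edges of the book are the spine s, the spokes a_i and b_i, and the pages r_i. For an
-- eigenvector with eigenvalue μ put α = 2 - μ, β = 2 + k - μ and D = α β - 2. Then
--   α r_i = a_i + b_i,   β a_i = Σ a + s + r_i,   β b_i = Σ b + s + r_i,   (2 k - μ) s = Σ a + Σ b.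
-- Summing over i gives μ Q s = 0, where Q = D + k (4 - μ); if s = 0 and α, β, D are nonzero, the
-- eigenvector vanishes. So every eigenvalue is a root of μ α β D Q. The value λ₂ is the smaller
-- root of D, attained on functions with s = 0 whose values sum to zero over the pages. That
-- nothing but μ vanishes below λ₂ follows from D = t (t + σ), t = λ₂ - μ > 0, σ = √(k² + 8).
-- Constructively, a factor that is not ≈ 0 may be cancelled because every real is either apart
-- from 0 or eventually smaller than a given ε > 0.
module Submission where

open import Algebra.Bundles using (CommutativeRing)
open import Data.Bool.Base using (if_then_else_; true; false)
open import Data.Empty using (⊥)
open import Data.Fin.Base as Fin using (Fin; zero; suc; _↑ˡ_; _↑ʳ_; splitAt; combine)
open import Data.Fin.Patterns using (0F; 1F)
open import Data.Fin.Permutation using (Permutation; permutation)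
import Data.Fin.Properties as Fin
open import Data.Integer.Base as ℤ using (+_)
import Data.Integer.Properties as ℤ
open import Data.List.Base using (List; length; lookup; filter; tabulate; allFin; cartesianProduct)
open import Data.List.Membership.Propositional using (_∈_)
open import Data.List.Membership.Propositional.Properties
  using (∈-allFin; ∈-cartesianProduct⁺; ∈-filter⁺; ∈-filter⁻; ∈-lookup)
import Data.List.Relation.Unary.All as All
open import Data.List.Relation.Unary.AllPairs using (_∷_)
open import Data.List.Relation.Unary.Any using (index)
open import Data.List.Relation.Unary.Any.Properties using (lookup-index)
open import Data.List.Relation.Unary.Unique.Propositional using (Unique)
import Data.List.Relation.Unary.Unique.Propositional.Properties as Unique
open import Data.Nat.Base as ℕ using (ℕ; zero; suc)
import Data.Nat.Properties as ℕ
open import Data.Nat.Tactic.RingSolver using (solve-∀)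
open import Data.Product using (∃-syntax; _×_; _,_; proj₁; proj₂; map)
open import Data.Rational.Base as ℚ using (ℚ; 0ℚ; 1ℚ; ½; ∣_∣)
import Data.Rational.Properties as ℚ
import Data.Rational.Solver as ℚSolver
import Data.Rational.Unnormalised.Base as ℚᵘ
import Data.Rational.Unnormalised.Properties as ℚᵘ
open import Data.Sum.Base using (_⊎_; inj₁; inj₂; [_,_]′)
open import Data.Unit.Base using (⊤; tt)
open import Data.Vec.Functional using (Vector)
open import Function.Base using (_∘_; id)
open import Function.Bundles using (_⇔_; mk⇔; Equivalence)
open import Level using (0ℓ)
open import Relation.Binary.PropositionalEquality
  using (_≡_; _≢_; refl; sym; trans; cong; cong₂; subst; subst₂)
import Relation.Binary.Reasoning.Setoid as SetoidReasoning
open import Relation.Nullary using (¬_; Dec; yes; no; does; contradiction)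
open import Relation.Nullary.Decidable using (does-⇔; _×-dec_)
open import Relation.Unary using (Pred; Decidable)
open import Defs

open CommutativeRing +-*-commutativeRing using (semiring)
open import Algebra.Properties.Semiring.Sum semiring
  using (∑-distrib-+; *-distribˡ-sum; *-distribʳ-sum; sum-permute; sum-cong-≋; sum-replicate-zero)
open ℚSolver.+-*-Solver using (Polynomial; solve; con; _:=_; _:+_; _:*_; _:-_; :-_)

-- Square roots of natural numbers

ι : ℕ → ℚ
ι n = + n ℚ./ 1

toℚᵘ-/ : ∀ a n → ℚ.toℚᵘ (+ a ℚ./ suc n) ℚᵘ.≃ ℚᵘ.mkℚᵘ (+ a) n
toℚᵘ-/ a n = ℚ.toℚᵘ-fromℚᵘ (ℚᵘ.mkℚᵘ (+ a) n)

ι-+ : ∀ m n → ι (m ℕ.+ n) ≡ ι m ℚ.+ ι n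
ι-+ m n = ℚ.toℚᵘ-injective
  (ℚᵘ.≃-trans (toℚᵘ-/ (m ℕ.+ n) 0)
    (ℚᵘ.≃-sym
      (ℚᵘ.≃-trans (ℚ.toℚᵘ-homo-+ (ι m) (ι n))
        (ℚᵘ.≃-trans (ℚᵘ.+-cong (toℚᵘ-/ m 0) (toℚᵘ-/ n 0))
          (ℚᵘ.*≡* (cong (ℤ._* ℤ.1ℤ)
            (cong₂ ℤ._+_ (ℤ.*-identityʳ (+ m)) (ℤ.*-identityʳ (+ n)))))))))

ι-* : ∀ m n → ι (m ℕ.* n) ≡ ι m ℚ.* ι n
ι-* m n = ℚ.toℚᵘ-injective
  (ℚᵘ.≃-trans (toℚᵘ-/ (m ℕ.* n) 0)
    (ℚᵘ.≃-sym
      (ℚᵘ.≃-trans (ℚ.toℚᵘ-homo-* (ι m) (ι n))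
        (ℚᵘ.≃-trans (ℚᵘ.*-cong (toℚᵘ-/ m 0) (toℚᵘ-/ n 0))
          (ℚᵘ.*≡* (cong (ℤ._* ℤ.1ℤ) (sym (ℤ.pos-* m n))))))))

/-*-cancel : ∀ a n → + a ℚ./ suc n ℚ.* ι (suc n) ≡ ι a
/-*-cancel a n = ℚ.toℚᵘ-injective
  (ℚᵘ.≃-trans (ℚ.toℚᵘ-homo-* (+ a ℚ./ suc n) (ι (suc n)))
    (ℚᵘ.≃-trans (ℚᵘ.*-cong (toℚᵘ-/ a n) (toℚᵘ-/ (suc n) 0))
      (ℚᵘ.≃-trans
        (ℚᵘ.*≡* (trans (ℤ.*-identityʳ (+ a ℤ.* + suc n))
                  (cong (λ m → + a ℤ.* + suc m) (sym (ℕ.*-identityʳ n)))))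
        (ℚᵘ.≃-sym (toℚᵘ-/ a 0)))))

0≤ι : ∀ n → 0ℚ ℚ.≤ ι n
0≤ι n = ℚ.nonNegative⁻¹ (ι n) {{ℚ.normalize-nonNeg n 1}}

ι-suc-positive : ∀ n → ℚ.Positive (ι (suc n))
ι-suc-positive n = ℚ.normalize-pos (suc n) 1

ι-mono-≤ : ∀ {m n} → m ℕ.≤ n → ι m ℚ.≤ ι n
ι-mono-≤ {m} m≤n with o , refl ← ℕ.m≤n⇒∃[o]m+o≡n m≤n =
  subst₂ ℚ._≤_ (ℚ.+-identityʳ (ι m)) (sym (ι-+ m o)) (ℚ.+-monoʳ-≤ (ι m) (0≤ι o))

ι-mono-< : ∀ {m n} → m ℕ.< n → ι m ℚ.< ι n
ι-mono-< {m} m<n = ℚ.<-≤-trans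
  (subst₂ ℚ._<_ (ℚ.+-identityˡ (ι m)) (sym (ι-+ 1 m))
    (ℚ.+-monoˡ-< (ι m) (ℚ.positive⁻¹ 1ℚ)))
  (ι-mono-≤ m<n)

archimedean : ∀ b {ε} → 0ℚ ℚ.< ε → ∃[ N ] (∀ n → N ℕ.≤ n → ι b ℚ.< ε ℚ.* ι (suc n))
-- For `ε = (p + 1) / (q + 1)` the claim reads `b (q + 1) < (p + 1) (n + 1)` once denominators are
-- cleared, and already `b (q + 1) < n + 1` holds.
archimedean b {ε@(ℚ.mkℚ (+ suc p) q _)} _ = b ℕ.* suc q , λ n N≤n →
  ℚ.*-cancelʳ-<-nonNeg (ι (suc q)) {{ℚ.normalize-nonNeg (suc q) 1}}
    (subst₂ ℚ._<_ (ι-* b (suc q))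
      (trans (ι-* (suc p) (suc n))
        (trans (cong (ℚ._* ι (suc n)) (sym (/-*-cancel (suc p) q)))
          (trans (swap (+ suc p ℚ./ suc q) (ι (suc q)) (ι (suc n)))
            (cong (λ r → r ℚ.* ι (suc n) ℚ.* ι (suc q)) (ℚ.↥p/↧p≡p ε)))))
      (ι-mono-< (ℕ.<-≤-trans (ℕ.s≤s N≤n) (ℕ.m≤m+n (suc n) (p ℕ.* suc n)))))
  where
  swap : ∀ x y z → x ℚ.* y ℚ.* z ≡ x ℚ.* z ℚ.* y
  swap = solve 3 (λ x y z → x :* y :* z := x :* z :* y) refl
archimedean b {ℚ.mkℚ (+ zero) _ _} (ℚ.*<* (ℤ.+<+ ()))
archimedean b {ℚ.mkℚ (ℤ.-[1+ _ ]) _ _} (ℚ.*<* ())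

fromℕ-+ : ∀ m n → fromℕ (m ℕ.+ n) ≈ fromℕ m + fromℕ n
fromℕ-+ m n = pointwise λ _ → ι-+ m n

fromℕ-* : ∀ m n → fromℕ (m ℕ.* n) ≈ fromℕ m * fromℕ n
fromℕ-* m n = pointwise λ _ → ι-* m n

-- A crude bound from `a ≤ (a + 1)²`. It serves to make the rounding error in `isqrt-gap` linear in
-- `d`.
isqrt-≤ : ∀ a d → isqrt (a ℕ.* (d ℕ.* d)) ℕ.≤ suc a ℕ.* d
isqrt-≤ a d = ℕ.≮⇒≥ λ over → ℕ.<-irrefl refl (begin-strict
  a ℕ.* (d ℕ.* d)                          ≤⟨ ℕ.m≤m+n _ _ ⟩
  a ℕ.* (d ℕ.* d) ℕ.+ (suc a ℕ.+ a ℕ.* a) ℕ.* (d ℕ.* d)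
                                           ≡⟨ square a d ⟩
  suc a ℕ.* d ℕ.* (suc a ℕ.* d)            <⟨ ℕ.*-mono-< over over ⟩
  r ℕ.* r                                  ≤⟨ isqrt-lower (a ℕ.* (d ℕ.* d)) ⟩
  a ℕ.* (d ℕ.* d)                          ∎)
  where
  open ℕ.≤-Reasoning
  r = isqrt (a ℕ.* (d ℕ.* d))
  square : ∀ a d → a ℕ.* (d ℕ.* d) ℕ.+ (suc a ℕ.+ a ℕ.* a) ℕ.* (d ℕ.* d)
                 ≡ suc a ℕ.* d ℕ.* (suc a ℕ.* d)
  square = solve-∀

-- With `r` the integer root, `a d² < (r + 1)²` leaves a defect of at most `2 r`, which `isqrt-≤`
-- bounds. Divided by `d²` the defect is of order `1 / d`; this drives the convergence in
-- `√-square`.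
isqrt-gap : ∀ a d → a ℕ.* (d ℕ.* d) ℕ.≤
  isqrt (a ℕ.* (d ℕ.* d)) ℕ.* isqrt (a ℕ.* (d ℕ.* d)) ℕ.+ 2 ℕ.* suc a ℕ.* d
isqrt-gap a d = ℕ.s≤s⁻¹ (begin
  suc (a ℕ.* (d ℕ.* d))                   ≤⟨ isqrt-upper (a ℕ.* (d ℕ.* d)) ⟩
  suc r ℕ.* suc r                         ≡⟨ expand r ⟩
  suc (r ℕ.* r ℕ.+ 2 ℕ.* r)               ≤⟨ ℕ.s≤s (ℕ.+-monoʳ-≤ (r ℕ.* r)
                                               (ℕ.*-monoʳ-≤ 2 (isqrt-≤ a d))) ⟩
  suc (r ℕ.* r ℕ.+ 2 ℕ.* (suc a ℕ.* d))   ≡⟨ cong (λ x → suc (r ℕ.* r ℕ.+ x))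
                                               (sym (ℕ.*-assoc 2 (suc a) d)) ⟩
  suc (r ℕ.* r ℕ.+ 2 ℕ.* suc a ℕ.* d)     ∎)
  where
  open ℕ.≤-Reasoning
  r = isqrt (a ℕ.* (d ℕ.* d))
  expand : ∀ r → suc r ℕ.* suc r ≡ suc (r ℕ.* r ℕ.+ 2 ℕ.* r)
  expand = solve-∀

√-approx-lower : ∀ a n → √-approx a n ℚ.* √-approx a n ℚ.≤ ι a
√-approx-lower a n = ℚ.*-cancelʳ-≤-pos D {{D⁺}} (ℚ.*-cancelʳ-≤-pos D {{D⁺}}
  (subst₂ ℚ._≤_
    (trans (ι-* r r)
      (trans (sym (cong₂ ℚ._*_ (/-*-cancel r n) (/-*-cancel r n)))
        (solve 2 (λ x d → x :* d :* (x :* d) := x :* x :* d :* d) refl (√-approx a n) D)))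
    (trans (ι-* a _)
      (trans (cong (ι a ℚ.*_) (ι-* (suc n) (suc n))) (sym (ℚ.*-assoc (ι a) D D))))
    (ι-mono-≤ (isqrt-lower (a ℕ.* (suc n ℕ.* suc n))))))
  where
  D   = ι (suc n)
  D⁺  = ι-suc-positive n
  r   = isqrt (a ℕ.* (suc n ℕ.* suc n))

-- For `d = n + 1` and `r = x d`, `isqrt-gap` says `(a - x²) d² ≤ 2 (a + 1) d`; one factor `d`
-- cancels.
√-approx-upper : ∀ a n → (ι a ℚ.- √-approx a n ℚ.* √-approx a n) ℚ.* ι (suc n) ℚ.≤ ι (2 ℕ.* suc a)
√-approx-upper a n = ℚ.*-cancelʳ-≤-pos D {{D⁺}}
  (subst₂ ℚ._≤_
    (trans (cong (ℚ._- xD ℚ.* xD) (trans (ι-* a _) (cong (ι a ℚ.*_) (ι-* (suc n) (suc n)))))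
      (solve 3 (λ a x d → a :* (d :* d) :- x :* d :* (x :* d) := (a :- x :* x) :* d :* d)
        refl (ι a) (√-approx a n) D))
    (trans (solve 2 (λ y z → y :+ z :- y := z) refl (xD ℚ.* xD) (ι (2 ℕ.* suc a ℕ.* suc n)))
      (ι-* (2 ℕ.* suc a) (suc n)))
    (ℚ.+-monoˡ-≤ (ℚ.- (xD ℚ.* xD))
      (subst (ι (a ℕ.* (suc n ℕ.* suc n)) ℚ.≤_)
        (trans (ι-+ (r ℕ.* r) _)
          (cong (ℚ._+ ι (2 ℕ.* suc a ℕ.* suc n))
            (trans (ι-* r r) (sym (cong₂ ℚ._*_ (/-*-cancel r n) (/-*-cancel r n))))))
        (ι-mono-≤ (isqrt-gap a (suc n))))))
  where
  D   = ι (suc n)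
  D⁺  = ι-suc-positive n
  r   = isqrt (a ℕ.* (suc n ℕ.* suc n))
  xD  = √-approx a n ℚ.* D

√-square : ∀ a → √ a * √ a ≈ fromℕ a
√-square a = close λ ε ε>0 →
  let N , small = archimedean (2 ℕ.* suc a) ε>0 in N , λ n n≥N →
  let x² = √-approx a n ℚ.* √-approx a n
      0≤a-x² = subst (ℚ._≤ ι a ℚ.- x²) (ℚ.+-inverseʳ x²)
                 (ℚ.+-monoˡ-≤ (ℚ.- x²) (√-approx-lower a n))
  in subst (ℚ._< ε)
       (trans (sym (ℚ.0≤p⇒∣p∣≡p 0≤a-x²))
         (trans (sym (ℚ.∣-p∣≡∣p∣ (ι a ℚ.- x²)))
           (cong ∣_∣ (solve 2 (λ a y → :- (a :- y) := y :- a) refl (ι a) x²))))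
       (ℚ.*-cancelʳ-<-nonNeg (ι (suc n)) {{ℚ.normalize-nonNeg (suc n) 1}}
         (ℚ.≤-<-trans (√-approx-upper a n) (small n n≥N)))

-- Signs and cancellation

record Positive (x : ℝ) : Set where
  constructor positive
  field
    bound    : ℚ
    bound>0  : 0ℚ ℚ.< bound
    start    : ℕ
    bound≤   : ∀ n → start ℕ.≤ n → bound ℚ.≤ seq x n

-- A condition on the representing sequence, stronger than `0ℝ ≤ x` and not invariant under `≈`. In
-- exchange it is closed under sums and products termwise.
record NonNegative (x : ℝ) : Set where
  constructor nonNegative
  field
    start : ℕ
    0≤    : ∀ n → start ℕ.≤ n → 0ℚ ℚ.≤ seq x n

positive⇒nonNegative : ∀ {x} → Positive x → NonNegative x
positive⇒nonNegative (positive g g>0 N g≤x) =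
  nonNegative N λ n n≥ → ℚ.≤-trans (ℚ.<⇒≤ g>0) (g≤x n n≥)

positive-resp : ∀ {x y} → (∀ n → seq x n ≡ seq y n) → Positive x → Positive y
positive-resp x≡y (positive g g>0 N g≤x) = positive g g>0 N λ n n≥ →
  subst (g ℚ.≤_) (x≡y n) (g≤x n n≥)

≉0-resp : ∀ {x y} → x ≈ y → y ≉ 0ℝ → x ≉ 0ℝ
≉0-resp x≈y y≉0 x≈0 = y≉0 (≈-trans (≈-sym x≈y) x≈0)

positive⇒≉0 : ∀ {x} → Positive x → x ≉ 0ℝ
positive⇒≉0 {x} (positive g g>0 N g≤x) x≈0 with M , near ← closeness x≈0 g g>0 =
  ℚ.<-irrefl refl (ℚ.≤-<-trans
    (subst (g ℚ.≤_) (sym (trans (cong ∣_∣ (ℚ.+-identityʳ p))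
                           (ℚ.0≤p⇒∣p∣≡p (ℚ.≤-trans (ℚ.<⇒≤ g>0) g≤p)))) g≤p)
    (near _ (ℕ.m≤n⊔m N M)))
  where
  p   = seq x (N ℕ.⊔ M)
  g≤p = g≤x (N ℕ.⊔ M) (ℕ.m≤m⊔n N M)

0≤p*q : ∀ {p q} → 0ℚ ℚ.≤ p → 0ℚ ℚ.≤ q → 0ℚ ℚ.≤ p ℚ.* q
0≤p*q {p} {q} 0≤p 0≤q = subst (ℚ._≤ p ℚ.* q) (ℚ.*-zeroʳ p)
  (ℚ.*-monoˡ-≤-nonNeg p {{ℚ.nonNegative 0≤p}} 0≤q)

positive-+ : ∀ {x y} → Positive x → NonNegative y → Positive (x + y)
positive-+ (positive g g>0 M g≤x) (nonNegative N 0≤y) = positive g g>0 (M ℕ.⊔ N) λ n n≥ →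
  subst (ℚ._≤ _) (ℚ.+-identityʳ g)
    (ℚ.+-mono-≤ (g≤x n (ℕ.m⊔n≤o⇒m≤o M N n≥)) (0≤y n (ℕ.m⊔n≤o⇒n≤o M N n≥)))

nonNegative-+ : ∀ {x y} → NonNegative x → NonNegative y → NonNegative (x + y)
nonNegative-+ (nonNegative M 0≤x) (nonNegative N 0≤y) = nonNegative (M ℕ.⊔ N) λ n n≥ →
  ℚ.+-mono-≤ (0≤x n (ℕ.m⊔n≤o⇒m≤o M N n≥)) (0≤y n (ℕ.m⊔n≤o⇒n≤o M N n≥))

positive-* : ∀ {x y} → Positive x → Positive y → Positive (x * y)
positive-* {x} {y} (positive g g>0 M g≤x) (positive h h>0 N h≤y) = positive
  (g ℚ.* h)
  (ℚ.positive⁻¹ _ {{ℚ.pos*pos⇒pos g {{ℚ.positive g>0}} h {{ℚ.positive h>0}}}})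
  (M ℕ.⊔ N)
  λ n n≥ → let g≤p = g≤x n (ℕ.m⊔n≤o⇒m≤o M N n≥) in ℚ.≤-trans
      (ℚ.*-monoʳ-≤-nonNeg h {{ℚ.nonNegative (ℚ.<⇒≤ h>0)}} g≤p)
      (ℚ.*-monoˡ-≤-nonNeg (seq x n) {{ℚ.nonNegative (ℚ.≤-trans (ℚ.<⇒≤ g>0) g≤p)}}
        (h≤y n (ℕ.m⊔n≤o⇒n≤o M N n≥)))

nonNegative-* : ∀ {x y} → NonNegative x → NonNegative y → NonNegative (x * y)
nonNegative-* (nonNegative M 0≤x) (nonNegative N 0≤y) = nonNegative (M ℕ.⊔ N) λ n n≥ →
  0≤p*q (0≤x n (ℕ.m⊔n≤o⇒m≤o M N n≥)) (0≤y n (ℕ.m⊔n≤o⇒n≤o M N n≥))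

fromℕ-nonNegative : ∀ n → NonNegative (fromℕ n)
fromℕ-nonNegative n = nonNegative 0 λ _ _ → 0≤ι n

fromℕ-positive : ∀ n → Positive (fromℕ (suc n))
fromℕ-positive n = positive (ι (suc n)) (ℚ.positive⁻¹ _ {{ι-suc-positive n}}) 0 λ _ _ → ℚ.≤-refl

√-nonNegative : ∀ a → NonNegative (√ a)
√-nonNegative a = nonNegative 0 λ n _ →
  ℚ.nonNegative⁻¹ _ {{ℚ.normalize-nonNeg (isqrt (a ℕ.* (suc n ℕ.* suc n))) (suc n)}}

<⇒positive : ∀ {x y} → x < y → Positive (y - x)
<⇒positive {x} {y} (below g g>0 N x+g≤y) = positive g g>0 N λ n n≥ →
  subst (ℚ._≤ seq y n ℚ.- seq x n)
    (solve 2 (λ p g → p :+ g :- p := g) refl (seq x n) g)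
    (ℚ.+-monoˡ-≤ (ℚ.- seq x n) (x+g≤y n n≥))

Apart : ℝ → Set
Apart x = ∃[ g ] (0ℚ ℚ.< g × ∃[ N ] (∀ n → N ℕ.≤ n → g ℚ.≤ ∣ seq x n ∣))

½-positive : ∀ {ε} → 0ℚ ℚ.< ε → 0ℚ ℚ.< ½ ℚ.* ε
½-positive {ε} ε>0 = ℚ.positive⁻¹ _ {{ℚ.pos*pos⇒pos ½ ε {{ℚ.positive ε>0}}}}

-- A single rational comparison decides. Beyond some index the sequence moves by less than `ε / 4`;
-- the absolute value of that term is compared with `ε / 2`. Later terms then stay below `ε` or keep
-- at least `ε / 4` away from zero. The two outcomes overlap, which is why the choice is
-- constructive.
apart-or-small : ∀ x {ε} → 0ℚ ℚ.< ε →
  Apart x ⊎ ∃[ N ] (∀ n → N ℕ.≤ n → ∣ seq x n ∣ ℚ.< ε)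
apart-or-small x {ε} ε>0 = decide
  where
  open ℚ.≤-Reasoning
  δ   = ½ ℚ.* ε
  δ>0 = ½-positive ε>0
  η   = ½ ℚ.* δ
  η>0 = ½-positive δ>0

  η+η≡δ : η ℚ.+ η ≡ δ
  η+η≡δ = solve 1 (λ d → con ½ :* d :+ con ½ :* d := d) refl δ

  δ+δ≡ε : δ ℚ.+ δ ≡ ε
  δ+δ≡ε = solve 1 (λ d → con ½ :* d :+ con ½ :* d := d) refl ε

  triangle : ∀ p q → ∣ p ∣ ℚ.≤ ∣ q ∣ ℚ.+ ∣ p ℚ.- q ∣
  triangle p q = subst (λ r → ∣ r ∣ ℚ.≤ ∣ q ∣ ℚ.+ ∣ p ℚ.- q ∣)
    (solve 2 (λ p q → q :+ (p :- q) := p) refl p q) (ℚ.∣p+q∣≤∣p∣+∣q∣ q (p ℚ.- q))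

  decide : Apart x ⊎ ∃[ N ] (∀ n → N ℕ.≤ n → ∣ seq x n ∣ ℚ.< ε)
  decide with N , near ← cauchy x η η>0 with ∣ seq x N ∣ ℚ.<? δ
  ... | yes small = inj₂ (N , λ n n≥ → begin-strict
    ∣ seq x n ∣                                    ≤⟨ triangle (seq x n) (seq x N) ⟩
    ∣ seq x N ∣ ℚ.+ ∣ seq x n ℚ.- seq x N ∣        <⟨ ℚ.+-mono-< small (near n N n≥ ℕ.≤-refl) ⟩
    δ ℚ.+ η                                        ≤⟨ ℚ.+-monoʳ-≤ δ
      (subst₂ ℚ._≤_ (ℚ.+-identityʳ η) η+η≡δ (ℚ.+-monoʳ-≤ η (ℚ.<⇒≤ η>0))) ⟩
    δ ℚ.+ δ                                        ≡⟨ δ+δ≡ε ⟩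
    ε                                              ∎)
  ... | no large = inj₁ (η , η>0 , N , λ n n≥ →
    let d = ∣ seq x N ℚ.- seq x n ∣ in begin
    η                                    ≡⟨ solve 1 (λ h → h := h :+ h :- h) refl η ⟩
    η ℚ.+ η ℚ.- η                        ≡⟨ cong (ℚ._- η) η+η≡δ ⟩
    δ ℚ.- η                              ≤⟨ ℚ.+-monoˡ-≤ (ℚ.- η) (ℚ.≮⇒≥ large) ⟩
    ∣ seq x N ∣ ℚ.- η                    ≤⟨ ℚ.+-monoˡ-≤ (ℚ.- η) (triangle (seq x N) (seq x n)) ⟩
    ∣ seq x n ∣ ℚ.+ d ℚ.- η              ≤⟨ ℚ.+-monoˡ-≤ (ℚ.- η)
      (ℚ.+-monoʳ-≤ ∣ seq x n ∣ (ℚ.<⇒≤ (near N n ℕ.≤-refl n≥))) ⟩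
    ∣ seq x n ∣ ℚ.+ η ℚ.- η              ≡⟨ solve 2 (λ p h → p :+ h :- h := p) refl ∣ seq x n ∣ η ⟩
    ∣ seq x n ∣                          ∎)

apart-cancel : ∀ {x z} → Apart z → x * z ≈ 0ℝ → x ≈ 0ℝ
apart-cancel {x} {z} (g , g>0 , N , g≤z) xz≈0 = close λ ε ε>0 →
  -- The tolerance is `ε g` because `∣ x ∣ g ≤ ∣ x z ∣` for late terms.
  let M , near = closeness xz≈0 (ε ℚ.* g)
                   (ℚ.positive⁻¹ _ {{ℚ.pos*pos⇒pos ε {{ℚ.positive ε>0}} g {{ℚ.positive g>0}}}})
  in M ℕ.⊔ N , λ n n≥ →
    let p = seq x n; q = seq z n in
    subst (λ r → ∣ r ∣ ℚ.< ε) (sym (ℚ.+-identityʳ p))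
      (ℚ.*-cancelʳ-<-nonNeg g {{ℚ.nonNegative (ℚ.<⇒≤ g>0)}} (ℚ.≤-<-trans
        (ℚ.*-monoˡ-≤-nonNeg ∣ p ∣ {{ℚ.∣-∣-nonNeg p}} (g≤z n (ℕ.m⊔n≤o⇒n≤o M N n≥)))
        (subst (ℚ._< ε ℚ.* g)
          (trans (cong ∣_∣ (ℚ.+-identityʳ (p ℚ.* q))) (ℚ.∣p*q∣≡∣p∣*∣q∣ p q))
          (near n (ℕ.m⊔n≤o⇒m≤o M N n≥)))))

-- About `x` only a negation is known, so the alternative is taken for `z`, one `ε` at a time: if
-- `z` were apart from zero, cancelling it would give `x ≈ 0ℝ`; otherwise `z` is eventually smaller
-- than `ε`.
≉0-cancel : ∀ {x z} → x ≉ 0ℝ → x * z ≈ 0ℝ → z ≈ 0ℝ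
≉0-cancel {x} {z} x≉0 xz≈0 = close λ ε ε>0 → small ε (apart-or-small z ε>0)
  where
  small : ∀ ε → Apart z ⊎ ∃[ N ] (∀ n → N ℕ.≤ n → ∣ seq z n ∣ ℚ.< ε) →
    ∃[ N ] (∀ n → N ℕ.≤ n → ∣ seq z n ℚ.- 0ℚ ∣ ℚ.< ε)
  small ε (inj₁ z#0)        = contradiction (apart-cancel z#0 xz≈0) x≉0
  small ε (inj₂ (N , z<ε)) = N , λ n n≥ →
    subst (λ r → ∣ r ∣ ℚ.< ε) (sym (ℚ.+-identityʳ (seq z n))) (z<ε n n≥)

infixr 7 _⊗_
infixl 6 _⊕_

_⊗_ : ∀ c {x y} → x ≈ y → c * (x - y) ≈ 0ℝ
_⊗_ c {x} {y} x≈y = ≈-trans (*-cong ≈-refl (+-cong x≈y ≈-refl))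
  (pointwise λ n → solve 2 (λ c y → c :* (y :- y) := con 0ℚ) refl (seq c n) (seq y n))

_⊕_ : ∀ {x y} → x ≈ 0ℝ → y ≈ 0ℝ → x + y ≈ 0ℝ
x≈0 ⊕ y≈0 = ≈-trans (+-cong x≈0 y≈0) (+-identityˡ 0ℝ)

-- z is a combination of hypotheses built with _⊗_ and _⊕_, so that only a polynomial identity
-- remains for the ring solver.
linear : ∀ {p q z} → z ≈ 0ℝ → (∀ n → seq p n ℚ.- seq q n ≡ seq z n) → p ≈ q
linear {p} {q} {z} z≈0 p-q≡z = ≈-trans
  (pointwise λ n → trans
    (solve 2 (λ p q → p := p :- q :+ q) refl (seq p n) (seq q n))
    (cong (ℚ._+ seq q n) (p-q≡z n)))
  (≈-trans (+-cong z≈0 ≈-refl) (+-identityˡ q))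

-- Sums and Laplacians

open SetoidReasoning setoid

sum-↑ : ∀ m {n} (f : Vector ℝ (m ℕ.+ n)) →
  sum f ≈ sum (λ i → f (i ↑ˡ n)) + sum (λ j → f (m ↑ʳ j))
sum-↑ zero    f = ≈-sym (+-identityˡ (sum f))
sum-↑ (suc m) f = ≈-trans (+-cong ≈-refl (sum-↑ m (f ∘ suc))) (≈-sym (+-assoc _ _ _))

sum-const : ∀ n x → sum {n} (λ _ → x) ≈ fromℕ n * x
sum-const zero    x = linear ≈-refl λ i → solve 1 (λ x → con 0ℚ :- con 0ℚ :* x := con 0ℚ) refl (seq x i)
sum-const (suc n) x = begin
  x + sum {n} (λ _ → x)     ≈⟨ +-cong ≈-refl (sum-const n x) ⟩
  x + fromℕ n * x           ≈⟨ pointwise (λ i → solve 2 (λ x m → x :+ m :* x := (con 1ℚ :+ m) :* x)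
                                  refl (seq x i) (ι n)) ⟩
  (1ℝ + fromℕ n) * x        ≈⟨ *-cong (≈-sym (fromℕ-+ 1 n)) ≈-refl ⟩
  fromℕ (suc n) * x         ∎

sum-indicator : ∀ {n} (i : Fin n) (f : Vector ℝ n) →
  sum (λ j → if does (i Fin.≟ j) then f j else 0ℝ) ≈ f i
sum-indicator {suc n} zero    f = ≈-trans (+-cong ≈-refl (sum-replicate-zero n)) (+-identityʳ (f zero))
sum-indicator {suc n} (suc i) f = ≈-trans (+-identityˡ _) (sum-indicator i (f ∘ suc))

-- Stated for `tabulate f` so that the induction can shift `f`; for `f = id` it turns a degree into
-- a row sum of the adjacency matrix.
fromℕ-length-filter : ∀ {a} {A : Set a} {P : Pred A 0ℓ} (P? : Decidable P) {n} (f : Fin n → A) →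
  fromℕ (length (filter P? (tabulate f))) ≈ sum (λ j → if does (P? (f j)) then 1ℝ else 0ℝ)
fromℕ-length-filter P? {zero}  f = ≈-refl
fromℕ-length-filter P? {suc n} f with does (P? (f zero))
... | true  = ≈-trans (fromℕ-+ 1 (length (filter P? (tabulate (f ∘ suc))))) (+-cong ≈-refl (fromℕ-length-filter P? (f ∘ suc)))
... | false = ≈-trans (fromℕ-length-filter P? (f ∘ suc)) (≈-sym (+-identityˡ _))

-- The degree is a row sum of the adjacency matrix, so the diagonal contributes `v i` once for every
-- neighbour. In this form the term `j = i` vanishes whatever entry stands there.
laplacian-action : ∀ {n} (G : Graph n) v i →
  (laplacian G *ᵥ v) i ≈ sum (λ j → adjacencyMatrix G i j * (v i - v j))
laplacian-action {n} G v i = begin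
  sum (λ j → (D j - A j) * v j)
    ≈⟨ sum-cong-≋ (λ j → pointwise λ m →
         solve 3 (λ d a x → (d :- a) :* x := d :* x :+ a :* (:- x)) refl
           (seq (D j) m) (seq (A j) m) (seq (v j) m)) ⟩
  sum (λ j → D j * v j + A j * - v j)
    ≈⟨ ∑-distrib-+ (λ j → D j * v j) (λ j → A j * - v j) ⟩
  sum (λ j → D j * v j) + sum (λ j → A j * - v j)
    ≈⟨ +-cong diagonal ≈-refl ⟩
  sum (λ j → A j * v i) + sum (λ j → A j * - v j)
    ≈⟨ ∑-distrib-+ (λ j → A j * v i) (λ j → A j * - v j) ⟨
  sum (λ j → A j * v i + A j * - v j)
    ≈⟨ sum-cong-≋ (λ j → ≈-sym (*-distribˡ-+ (A j) (v i) (- v j))) ⟩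
  sum (λ j → A j * (v i - v j)) ∎
  where
  open Graph G
  d = fromℕ (degree G i)
  D = degreeMatrix G i
  A = adjacencyMatrix G i

  diagonal : sum (λ j → D j * v j) ≈ sum (λ j → A j * v i)
  diagonal = begin
    sum (λ j → D j * v j)
      ≈⟨ sum-cong-≋ (λ j → entry j) ⟩
    sum (λ j → if does (i Fin.≟ j) then d * v j else 0ℝ)
      ≈⟨ sum-indicator i (λ j → d * v j) ⟩
    d * v i
      ≈⟨ *-cong (fromℕ-length-filter (i ~?_) id) ≈-refl ⟩
    sum A * v i
      ≈⟨ *-distribʳ-sum (v i) A ⟩
    sum (λ j → A j * v i) ∎
    where
    entry : ∀ j → D j * v j ≈ (if does (i Fin.≟ j) then d * v j else 0ℝ)
    entry j with does (i Fin.≟ j)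
    ... | true  = ≈-refl
    ... | false = pointwise λ m → solve 1 (λ x → con 0ℚ :* x := con 0ℚ) refl (seq (v j) m)

-- The edges of the book

unique-lookup-injective : ∀ {a} {A : Set a} {xs : List A} → Unique xs →
  ∀ {i j} → lookup xs i ≡ lookup xs j → i ≡ j
unique-lookup-injective (x∉ ∷ u) {zero}  {zero}  eq = refl
unique-lookup-injective (x∉ ∷ u) {zero}  {suc j} eq =
  contradiction eq (All.lookup x∉ (∈-lookup j))
unique-lookup-injective (x∉ ∷ u) {suc i} {zero}  eq =
  contradiction (sym eq) (All.lookup x∉ (∈-lookup i))
unique-lookup-injective (x∉ ∷ u) {suc i} {suc j} eq =
  cong suc (unique-lookup-injective u eq)

edges-unique : ∀ {n} (G : Graph n) → Unique (edges G)
edges-unique {n} G = Unique.filter⁺ _ (Unique.cartesianProduct⁺ (Unique.allFin⁺ n) (Unique.allFin⁺ n))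

combine-monoʳ-< : ∀ {m n} (i : Fin m) {j l : Fin n} → j Fin.< l → combine i j Fin.< combine i l
combine-monoʳ-< {n = n} i {j} {l} j<l =
  subst₂ ℕ._<_ (sym (Fin.toℕ-combine i j)) (sym (Fin.toℕ-combine i l))
    (ℕ.+-monoʳ-< (n ℕ.* Fin.toℕ i) j<l)

-- `Fin 2` selects a copy of the star and `Fin k` a leaf: the spine joins the two centres,
-- `spoke y i` lies in copy `y`, and `page i` joins the two copies of leaf `i`.
data Edge (k : ℕ) : Set where
  spine : Edge k
  spoke : Fin 2 → Fin k → Edge k
  page  : Fin k → Edge k

≡⇒≈ : ∀ {x y : ℝ} → x ≡ y → x ≈ y
≡⇒≈ refl = ≈-refl

adjacency-entry : ∀ {n} (G : Graph n) {i j} {P : Set} (P? : Dec P) → Graph._~_ G i j ⇔ P →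
  adjacencyMatrix G i j ≈ (if does P? then 1ℝ else 0ℝ)
adjacency-entry G {i} {j} P? iff =
  ≡⇒≈ (cong (λ b → if b then 1ℝ else 0ℝ) (does-⇔ iff (Graph._~?_ G i j) P?))

*-self-difference : ∀ a b x → a * (x - x) ≈ b * (x - x)
*-self-difference a b x = pointwise λ n →
  solve 3 (λ a b x → a :* (x :- x) := b :* (x :- x)) refl (seq a n) (seq b n) (seq x n)

module _ {k : ℕ} where

  0F<1F : Fin._<_ {2} {2} 0F 1F
  0F<1F = ℕ.s≤s ℕ.z≤n

  Corner : Set
  Corner = Fin (suc k) × Fin 2

  vertex : Corner → Fin (suc k ℕ.* 2)
  vertex (x , y) = combine x y

  vertex-injective : ∀ p q → vertex p ≡ vertex q → p ≡ q
  vertex-injective (x , y) (x′ , y′) eq with refl , refl ← Fin.combine-injective x y x′ y′ eq = refl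

  -- The corner with the smaller `combine` value comes first, matching the orientation in `edges`.
  corners : Edge k → Corner × Corner
  corners spine       = (zero , 0F) , (zero , 1F)
  corners (spoke y i) = (zero , y) , (suc i , y)
  corners (page i)    = (suc i , 0F) , (suc i , 1F)

  corners-injective : ∀ {e f} → corners e ≡ corners f → e ≡ f
  corners-injective {spine}     {spine}     _    = refl
  corners-injective {spoke _ _} {spoke _ _} refl = refl
  corners-injective {page _}    {page _}    refl = refl
  corners-injective {spine}     {spoke _ _} ()
  corners-injective {spine}     {page _}    ()
  corners-injective {spoke _ _} {spine}     ()
  corners-injective {spoke _ _} {page _}    ()
  corners-injective {page _}    {spine}     ()
  corners-injective {page _}    {spoke _ _} ()

  ends : Edge k → Fin (suc k ℕ.* 2) × Fin (suc k ℕ.* 2)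
  ends e = map vertex vertex (corners e)

  ends-injective : ∀ {e f} → ends e ≡ ends f → e ≡ f
  ends-injective eq = corners-injective
    (cong₂ _,_ (vertex-injective _ _ (cong proj₁ eq)) (vertex-injective _ _ (cong proj₂ eq)))

  Adjacent : Corner → Corner → Set
  Adjacent (x , y) (x′ , y′) = (x ≡ x′ × y ≢ y′) ⊎ (y ≡ y′ × Graph._~_ (star k) x x′)

  ~⇔adjacent : ∀ p q → Graph._~_ (book k) (vertex p) (vertex q) ⇔ Adjacent p q
  ~⇔adjacent (x , y) (x′ , y′) = mk⇔
    (subst₂ Adjacent (Fin.remQuot-combine x y) (Fin.remQuot-combine x′ y′))
    (subst₂ Adjacent (sym (Fin.remQuot-combine x y)) (sym (Fin.remQuot-combine x′ y′)))

  ends-< : ∀ e → proj₁ (ends e) Fin.< proj₂ (ends e)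
  ends-< spine       = combine-monoʳ-< {suc k} {2} zero 0F<1F
  ends-< (spoke y i) = Fin.combine-monoˡ-< {i = zero} {suc i} y y (ℕ.s≤s ℕ.z≤n)
  ends-< (page i)    = combine-monoʳ-< (suc i) 0F<1F

  corners-adjacent : ∀ e → Adjacent (proj₁ (corners e)) (proj₂ (corners e))
  corners-adjacent spine       = inj₁ (refl , λ ())
  corners-adjacent (spoke y i) = inj₂ (refl , inj₁ (refl , λ ()))
  corners-adjacent (page i)    = inj₁ (refl , λ ())

  isEdge? : (pq : Fin (suc k ℕ.* 2) × Fin (suc k ℕ.* 2)) →
    Dec (proj₁ pq Fin.< proj₂ pq × Graph._~_ (book k) (proj₁ pq) (proj₂ pq))
  isEdge? (p , q) = (p Fin.<? q) ×-dec Graph._~?_ (book k) p q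

  ends∈edges : ∀ e → ends e ∈ edges (book k)
  ends∈edges e = ∈-filter⁺ isEdge? (∈-cartesianProduct⁺ (∈-allFin _) (∈-allFin _))
    (ends-< e , Equivalence.from (~⇔adjacent _ _) (corners-adjacent e))

  -- Adjacency alone admits both orientations of each edge. The order hypothesis rejects a leaf
  -- listed before the centre, and copy `1F` of a vertex listed before its copy `0F`.
  edge-of-corners : ∀ p q → vertex p Fin.< vertex q → Adjacent p q → ∃[ e ] corners e ≡ (p , q)
  edge-of-corners (zero  , 0F) (_ , 1F) _ (inj₁ (refl , _)) = spine , refl
  edge-of-corners (suc i , 0F) (_ , 1F) _ (inj₁ (refl , _)) = page i , refl
  edge-of-corners (_ , 0F) (_ , 0F) _ (inj₁ (_ , y≢y)) = contradiction refl y≢y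
  edge-of-corners (_ , 1F) (_ , 1F) _ (inj₁ (_ , y≢y)) = contradiction refl y≢y
  edge-of-corners (x , 1F) (_ , 0F) p<q (inj₁ (refl , _)) =
    contradiction p<q (ℕ.<⇒≯ (combine-monoʳ-< x 0F<1F))
  edge-of-corners (_ , y) (zero  , _) _ (inj₂ (_ , inj₁ (_ , x≢0))) = contradiction refl x≢0
  edge-of-corners (_ , y) (suc i , _) _ (inj₂ (refl , inj₁ (refl , _))) = spoke y i , refl
  edge-of-corners (zero  , y) _ _ (inj₂ (_ , inj₂ (x≢0 , _))) = contradiction refl x≢0
  edge-of-corners (suc i , y) _ p<q (inj₂ (refl , inj₂ (_ , refl))) =
    contradiction p<q (ℕ.<⇒≯ (Fin.combine-monoˡ-< {i = zero} {suc i} y y (ℕ.s≤s ℕ.z≤n)))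

  edge-of-ends : ∀ {p q} → (p , q) ∈ edges (book k) → ∃[ e ] ends e ≡ (p , q)
  edge-of-ends {p} {q} p,q∈ with Fin.combine-surjective {suc k} {2} p | Fin.combine-surjective {suc k} {2} q
  ... | x , y , refl | x′ , y′ , refl =
    let _ , p<q , p~q = ∈-filter⁻ isEdge? {xs = cartesianProduct (allFin _) (allFin _)} p,q∈
        e , eq        = edge-of-corners (x , y) (x′ , y′) p<q (Equivalence.to (~⇔adjacent _ _) p~q)
    in e , cong (map vertex vertex) eq

  -- Outside this block the numbering of the edges is known only through `lookup-position` and
  -- `ends-edgeAt`.
  abstract
    position : Edge k → Fin (length (edges (book k)))
    position e = index (ends∈edges e)

    lookup-position : ∀ e → lookup (edges (book k)) (position e) ≡ ends e
    lookup-position e = sym (lookup-index (ends∈edges e))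

    edgeAt : Fin (length (edges (book k))) → Edge k
    edgeAt x = proj₁ (edge-of-ends (∈-lookup {xs = edges (book k)} x))

    ends-edgeAt : ∀ x → ends (edgeAt x) ≡ lookup (edges (book k)) x
    ends-edgeAt x = proj₂ (edge-of-ends (∈-lookup {xs = edges (book k)} x))

  edgeAt-position : ∀ e → edgeAt (position e) ≡ e
  edgeAt-position e = ends-injective (trans (ends-edgeAt (position e)) (lookup-position e))

  position-injective : ∀ {e f} → position e ≡ position f → e ≡ f
  position-injective {e} {f} eq =
    trans (sym (edgeAt-position e)) (trans (cong edgeAt eq) (edgeAt-position f))

  -- No edge is listed twice, so a place in the list is determined by the edge it carries.
  position-edgeAt : ∀ x → position (edgeAt x) ≡ x
  position-edgeAt x = unique-lookup-injective (edges-unique (book k))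
    (trans (lookup-position (edgeAt x)) (ends-edgeAt x))

  -- Summation over the edges

  encode : Edge k → Fin (suc (k ℕ.+ (k ℕ.+ k)))
  encode spine        = zero
  encode (spoke 0F i) = suc (i ↑ˡ (k ℕ.+ k))
  encode (spoke 1F i) = suc (k ↑ʳ (i ↑ˡ k))
  encode (page i)     = suc (k ↑ʳ (k ↑ʳ i))

  decode : Fin (suc (k ℕ.+ (k ℕ.+ k))) → Edge k
  decode zero    = spine
  decode (suc x) = [ spoke 0F , [ spoke 1F , page ]′ ∘ splitAt k ]′ (splitAt k x)

  decode-encode : ∀ e → decode (encode e) ≡ e
  decode-encode spine        = refl
  decode-encode (spoke 0F i) rewrite Fin.splitAt-↑ˡ k i (k ℕ.+ k) = refl
  decode-encode (spoke 1F i)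
    rewrite Fin.splitAt-↑ʳ k (k ℕ.+ k) (i ↑ˡ k) | Fin.splitAt-↑ˡ k i k = refl
  decode-encode (page i)
    rewrite Fin.splitAt-↑ʳ k (k ℕ.+ k) (k ↑ʳ i) | Fin.splitAt-↑ʳ k k i = refl

  encode-decode : ∀ x → encode (decode x) ≡ x
  encode-decode zero = refl
  encode-decode (suc x) with splitAt k x in eq
  ... | inj₁ i = cong suc (Fin.splitAt⁻¹-↑ˡ eq)
  ... | inj₂ y with splitAt k y in eq′
  ...   | inj₁ i = cong suc (trans (cong (k ↑ʳ_) (Fin.splitAt⁻¹-↑ˡ eq′)) (Fin.splitAt⁻¹-↑ʳ eq))
  ...   | inj₂ i = cong suc (trans (cong (k ↑ʳ_) (Fin.splitAt⁻¹-↑ʳ eq′)) (Fin.splitAt⁻¹-↑ʳ eq))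

  enumeration : Permutation (suc (k ℕ.+ (k ℕ.+ k))) (length (edges (book k)))
  enumeration = permutation (position ∘ decode) (encode ∘ edgeAt)
    (λ x → trans (cong position (decode-encode (edgeAt x))) (position-edgeAt x))
    (λ x → trans (cong encode (edgeAt-position (decode x))) (encode-decode x))

  sumₑ : (Edge k → ℝ) → ℝ
  sumₑ f = f spine + (sum (f ∘ spoke 0F) + (sum (f ∘ spoke 1F) + sum (f ∘ page)))

  -- Reindexing along `enumeration` arranges the edges in four blocks: spine, two sets of spokes,
  -- pages. `sum-↑` then splits the sum at the block boundaries.
  sum-edges : ∀ g → sum g ≈ sumₑ (g ∘ position)
  sum-edges g = begin
    sum g                                     ≈⟨ sum-permute g enumeration ⟩
    h spine + sum (g∘π ∘ suc)                 ≈⟨ +-cong ≈-refl (sum-↑ k (g∘π ∘ suc)) ⟩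
    h spine + (sum (λ i → g∘π (encode (spoke 0F i))) + sum (λ y → g∘π (suc (k ↑ʳ y))))
      ≈⟨ +-cong ≈-refl (+-cong (sum-cong-≋ (at ∘ spoke 0F)) (sum-↑ k (λ y → g∘π (suc (k ↑ʳ y))))) ⟩
    h spine + (sum (h ∘ spoke 0F) +
      (sum (λ i → g∘π (encode (spoke 1F i))) + sum (λ i → g∘π (encode (page i)))))
      ≈⟨ +-cong ≈-refl (+-cong ≈-refl (+-cong (sum-cong-≋ (at ∘ spoke 1F)) (sum-cong-≋ (at ∘ page)))) ⟩
    sumₑ h ∎
    where
    g∘π = g ∘ position ∘ decode
    h   = g ∘ position

    at : ∀ e → g∘π (encode e) ≈ h e
    at e = pointwise λ n → cong (λ f → seq (h f) n) (decode-encode e)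

  -- Adjacency in the line graph and its Laplacian

  -- Only meant for distinct edges; on the diagonal the value is irrelevant.
  Meet : Edge k → Edge k → Set
  Meet spine       (spoke _ _) = ⊤
  Meet (spoke _ _) spine       = ⊤
  Meet (spoke y _) (spoke z _) = y ≡ z
  Meet (spoke _ i) (page j)    = i ≡ j
  Meet (page i)    (spoke _ j) = i ≡ j
  Meet _           _           = ⊥

  meet? : ∀ e f → Dec (Meet e f)
  meet? spine       spine       = no λ ()
  meet? spine       (spoke _ _) = yes tt
  meet? spine       (page _)    = no λ ()
  meet? (spoke _ _) spine       = yes tt
  meet? (spoke y _) (spoke z _) = y Fin.≟ z
  meet? (spoke _ i) (page j)    = i Fin.≟ j
  meet? (page _)    spine       = no λ ()
  meet? (page i)    (spoke _ j) = i Fin.≟ j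
  meet? (page _)    (page _)    = no λ ()

  Shared : Corner → Edge k → Edge k → Set
  Shared c e f = (c ≡ proj₁ (corners e) ⊎ c ≡ proj₂ (corners e)) ×
                 (c ≡ proj₁ (corners f) ⊎ c ≡ proj₂ (corners f))

  shared⇒meet : ∀ c e f → e ≢ f → Shared c e f → Meet e f
  shared⇒meet c spine       spine       e≢f _ = e≢f refl
  shared⇒meet c spine       (spoke _ _) _ _ = tt
  shared⇒meet c (spoke _ _) spine       _ _ = tt
  shared⇒meet c (spoke _ _) (spoke _ _) _ (inj₁ refl , inj₁ refl) = refl
  shared⇒meet c (spoke _ _) (spoke _ _) _ (inj₂ refl , inj₂ refl) = refl
  shared⇒meet c (spoke _ _) (page _)    _ (inj₂ refl , inj₁ refl) = refl
  shared⇒meet c (spoke _ _) (page _)    _ (inj₂ refl , inj₂ refl) = refl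
  shared⇒meet c (page _)    (spoke _ _) _ (inj₁ refl , inj₂ refl) = refl
  shared⇒meet c (page _)    (spoke _ _) _ (inj₂ refl , inj₂ refl) = refl
  shared⇒meet c (page _)    (page _)    e≢f (inj₁ refl , inj₁ refl) = e≢f refl
  shared⇒meet c (page _)    (page _)    e≢f (inj₂ refl , inj₂ refl) = e≢f refl
  shared⇒meet c spine       (page _)    _ (inj₁ refl , inj₁ ())
  shared⇒meet c spine       (page _)    _ (inj₁ refl , inj₂ ())
  shared⇒meet c spine       (page _)    _ (inj₂ refl , inj₁ ())
  shared⇒meet c spine       (page _)    _ (inj₂ refl , inj₂ ())
  shared⇒meet c (page _)    spine       _ (inj₁ refl , inj₁ ())
  shared⇒meet c (page _)    spine       _ (inj₁ refl , inj₂ ())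
  shared⇒meet c (page _)    spine       _ (inj₂ refl , inj₁ ())
  shared⇒meet c (page _)    spine       _ (inj₂ refl , inj₂ ())

  meet⇒shared : ∀ e f → Meet e f → ∃[ c ] Shared c e f
  meet⇒shared spine        (spoke 0F _) _ = _ , inj₁ refl , inj₁ refl
  meet⇒shared spine        (spoke 1F _) _ = _ , inj₂ refl , inj₁ refl
  meet⇒shared (spoke 0F _) spine        _ = _ , inj₁ refl , inj₁ refl
  meet⇒shared (spoke 1F _) spine        _ = _ , inj₁ refl , inj₂ refl
  meet⇒shared (spoke _ _)  (spoke _ _)  refl = _ , inj₁ refl , inj₁ refl
  meet⇒shared (spoke 0F _) (page _)     refl = _ , inj₂ refl , inj₁ refl
  meet⇒shared (spoke 1F _) (page _)     refl = _ , inj₂ refl , inj₂ refl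
  meet⇒shared (page _)     (spoke 0F _) refl = _ , inj₁ refl , inj₂ refl
  meet⇒shared (page _)     (spoke 1F _) refl = _ , inj₂ refl , inj₂ refl

  ∈ₑ-ends : ∀ v e → v ∈ₑ ends e →
    ∃[ c ] (v ≡ vertex c × (c ≡ proj₁ (corners e) ⊎ c ≡ proj₂ (corners e)))
  ∈ₑ-ends v e (inj₁ eq) = _ , eq , inj₁ refl
  ∈ₑ-ends v e (inj₂ eq) = _ , eq , inj₂ refl

  corner∈ₑ : ∀ c e → c ≡ proj₁ (corners e) ⊎ c ≡ proj₂ (corners e) → vertex c ∈ₑ ends e
  corner∈ₑ c e (inj₁ refl) = inj₁ refl
  corner∈ₑ c e (inj₂ refl) = inj₂ refl

  incident⇔meet : ∀ e f → e ≢ f →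
    Graph._~_ (lineGraph (book k)) (position e) (position f) ⇔ Meet e f
  incident⇔meet e f e≢f = mk⇔ forth back
    where
    forth : Graph._~_ (lineGraph (book k)) (position e) (position f) → Meet e f
    forth (_ , v , v∈e , v∈f)
      with c , eq , c∈e ← ∈ₑ-ends v e (subst (v ∈ₑ_) (lookup-position e) v∈e)
         | d , eq′ , d∈f ← ∈ₑ-ends v f (subst (v ∈ₑ_) (lookup-position f) v∈f)
      with refl ← vertex-injective c d (trans (sym eq) eq′) = shared⇒meet c e f e≢f (c∈e , d∈f)

    back : Meet e f → Graph._~_ (lineGraph (book k)) (position e) (position f)
    back m with c , c∈e , c∈f ← meet⇒shared e f m =
        (λ eq → e≢f (position-injective eq))
      , vertex c
      , subst (vertex c ∈ₑ_) (sym (lookup-position e)) (corner∈ₑ c e c∈e)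
      , subst (vertex c ∈ₑ_) (sym (lookup-position f)) (corner∈ₑ c f c∈f)

  _≟ₑ_ : (e f : Edge k) → Dec (e ≡ f)
  e ≟ₑ f with position e Fin.≟ position f
  ... | yes eq = yes (position-injective eq)
  ... | no neq = no λ eq → neq (cong position eq)

  -- On the diagonal the factor `v e - v e` vanishes, so any value of `Meet e e` gives the same
  -- term.
  adjacency-term : ∀ (v : Edge k → ℝ) e f →
    adjacencyMatrix (lineGraph (book k)) (position e) (position f) * (v e - v f) ≈
    (if does (meet? e f) then 1ℝ else 0ℝ) * (v e - v f)
  adjacency-term v e f with e ≟ₑ f
  ... | yes refl = *-self-difference _ _ (v e)
  ... | no e≢f   = *-cong
    (adjacency-entry (lineGraph (book k)) (meet? e f) (incident⇔meet e f e≢f)) ≈-refl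

  -- The Laplacian of the line graph in terms of edges. A spoke meets all other spokes of its copy;
  -- the sum may run over all `k` of them because the spoke's own difference is zero.
  action : (Edge k → ℝ) → Edge k → ℝ
  action v spine = (fromℕ k * v spine - sum (v ∘ spoke 0F)) + (fromℕ k * v spine - sum (v ∘ spoke 1F))
  action v e@(spoke y i) = (v e - v spine) + (fromℕ k * v e - sum (v ∘ spoke y)) + (v e - v (page i))
  action v e@(page i) = (v e - v (spoke 0F i)) + (v e - v (spoke 1F i))

  sum-differences : ∀ x (f : Vector ℝ k) → sum (λ i → 1ℝ * (x - f i)) ≈ fromℕ k * x - sum f
  sum-differences x f = begin
    sum (λ i → 1ℝ * (x - f i))
      ≈⟨ sum-cong-≋ (λ i → pointwise λ n →
           solve 2 (λ x y → con 1ℚ :* (x :- y) := x :+ con (ℚ.- 1ℚ) :* y) refl (seq x n) (seq (f i) n)) ⟩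
    sum (λ i → x + - 1ℝ * f i)
      ≈⟨ ∑-distrib-+ (λ _ → x) (λ i → - 1ℝ * f i) ⟩
    sum {k} (λ _ → x) + sum (λ i → - 1ℝ * f i)
      ≈⟨ +-cong (sum-const k x) (≈-sym (*-distribˡ-sum (- 1ℝ) f)) ⟩
    fromℕ k * x + - 1ℝ * sum f
      ≈⟨ pointwise (λ n → solve 2 (λ y z → y :+ con (ℚ.- 1ℚ) :* z := y :- z) refl
           (ι k ℚ.* seq x n) (seq (sum f) n)) ⟩
    fromℕ k * x - sum f ∎

  sum-vanishing : ∀ (f : Vector ℝ k) → sum (λ i → 0ℝ * f i) ≈ 0ℝ
  sum-vanishing f = ≈-trans (≈-sym (*-distribˡ-sum 0ℝ f))
    (pointwise λ n → solve 1 (λ x → con 0ℚ :* x := con 0ℚ) refl (seq (sum f) n))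

  sum-selected : ∀ i (f : Vector ℝ k) →
    sum (λ j → (if does (i Fin.≟ j) then 1ℝ else 0ℝ) * f j) ≈ f i
  sum-selected i f = ≈-trans (sum-cong-≋ entry) (sum-indicator i f)
    where
    entry : ∀ j → (if does (i Fin.≟ j) then 1ℝ else 0ℝ) * f j ≈ (if does (i Fin.≟ j) then f j else 0ℝ)
    entry j with does (i Fin.≟ j)
    ... | true  = *-identityˡ (f j)
    ... | false = pointwise λ n → solve 1 (λ x → con 0ℚ :* x := con 0ℚ) refl (seq (f j) n)

  laplacian-position : ∀ w e →
    (laplacian (lineGraph (book k)) *ᵥ w) (position e) ≈ action (w ∘ position) e
  laplacian-position w e = begin
    (laplacian (lineGraph (book k)) *ᵥ w) (position e)
      ≈⟨ laplacian-action (lineGraph (book k)) w (position e) ⟩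
    sum (λ x → adjacencyMatrix (lineGraph (book k)) (position e) x * (w (position e) - w x))
      ≈⟨ sum-edges (λ x → adjacencyMatrix (lineGraph (book k)) (position e) x * (w (position e) - w x)) ⟩
    sumₑ (λ f → adjacencyMatrix (lineGraph (book k)) (position e) (position f) * (v e - v f))
      ≈⟨ +-cong (adjacency-term v e spine) (+-cong (sum-cong-≋ (adjacency-term v e ∘ spoke 0F))
          (+-cong (sum-cong-≋ (adjacency-term v e ∘ spoke 1F)) (sum-cong-≋ (adjacency-term v e ∘ page)))) ⟩
    sumₑ (λ f → (if does (meet? e f) then 1ℝ else 0ℝ) * (v e - v f))
      ≈⟨ collect e ⟩
    action v e ∎
    where
    v = w ∘ position
    κ = fromℕ k

    -- According to `meet?`, each block of spokes or pages is met entirely, not at all, or in the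
    -- member `i` only; `sum-differences`, `sum-vanishing` and `sum-selected` evaluate these cases.
    collect : ∀ e → sumₑ (λ f → (if does (meet? e f) then 1ℝ else 0ℝ) * (v e - v f)) ≈ action v e
    collect spine = ≈-trans
      (+-cong ≈-refl (+-cong (sum-differences x _) (+-cong (sum-differences x _) (sum-vanishing _))))
      (pointwise λ n → solve 3
        (λ x a b → con 0ℚ :* (x :- x) :+ (a :+ (b :+ con 0ℚ)) := a :+ b) refl
        (seq x n) (seq (κ * x - sum (v ∘ spoke 0F)) n) (seq (κ * x - sum (v ∘ spoke 1F)) n))
      where x = v spine
    collect (spoke 0F i) = ≈-trans
      (+-cong ≈-refl (+-cong (sum-differences x _) (+-cong (sum-vanishing _) (sum-selected i _))))
      (pointwise λ n → solve 3
        (λ a b c → con 1ℚ :* a :+ (b :+ (con 0ℚ :+ c)) := a :+ b :+ c) refl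
        (seq (x - v spine) n) (seq (κ * x - sum (v ∘ spoke 0F)) n) (seq (x - v (page i)) n))
      where x = v (spoke 0F i)
    collect (spoke 1F i) = ≈-trans
      (+-cong ≈-refl (+-cong (sum-vanishing _) (+-cong (sum-differences x _) (sum-selected i _))))
      (pointwise λ n → solve 3
        (λ a b c → con 1ℚ :* a :+ (con 0ℚ :+ (b :+ c)) := a :+ b :+ c) refl
        (seq (x - v spine) n) (seq (κ * x - sum (v ∘ spoke 1F)) n) (seq (x - v (page i)) n))
      where x = v (spoke 1F i)
    collect (page i) = ≈-trans
      (+-cong ≈-refl (+-cong (sum-selected i _) (+-cong (sum-selected i _) (sum-vanishing _))))
      (pointwise λ n → solve 3
        (λ a b c → con 0ℚ :* a :+ (b :+ (c :+ con 0ℚ)) := b :+ c) refl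
        (seq (x - v spine) n) (seq (x - v (spoke 0F i)) n) (seq (x - v (spoke 1F i)) n))
      where x = v (page i)

-- Eigenvectors

α : ℝ → ℝ
α μ = fromℕ 2 - μ

β D Q : ℕ → ℝ → ℝ
β k μ = fromℕ 2 + fromℕ k - μ
D k μ = α μ * β k μ - fromℕ 2
Q k μ = D k μ + fromℕ k * (fromℕ 4 - μ)

-- The same expressions, reflected for the ring solver
private
  module _ {m : ℕ} where
    lit : ℕ → Polynomial m
    lit n = con (ι n)

    α′ : Polynomial m → Polynomial m
    α′ μ = lit 2 :- μ

    β′ D′ Q′ : Polynomial m → Polynomial m → Polynomial m
    β′ κ μ = lit 2 :+ κ :- μ
    D′ κ μ = α′ μ :* β′ κ μ :- lit 2
    Q′ κ μ = D′ κ μ :+ κ :* (lit 4 :- μ)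

module _ {k} {μ : ℝ} {v : Edge k → ℝ} (eigen : ∀ e → action v e ≈ μ * v e) where

  private
    κ s R : ℝ
    κ = fromℕ k
    s = v spine
    R = sum (v ∘ page)

    S : Fin 2 → ℝ
    S y = sum (v ∘ spoke y)

  spoke-equation : ∀ y i → β k μ * v (spoke y i) ≈ (S y + s) + v (page i)
  spoke-equation y i = linear (1ℝ ⊗ eigen (spoke y i)) λ n → solve 6
    (λ κ μ s S x r → β′ κ μ :* x :- (S :+ s :+ r) :=
      con 1ℚ :* ((x :- s) :+ (κ :* x :- S) :+ (x :- r) :- μ :* x))
    refl (ι k) (seq μ n) (seq s n) (seq (S y) n) (seq (v (spoke y i)) n) (seq (v (page i)) n)

  page-equation : ∀ i → α μ * v (page i) ≈ v (spoke 0F i) + v (spoke 1F i)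
  page-equation i = linear (1ℝ ⊗ eigen (page i)) λ n → solve 4
    (λ μ a b r → α′ μ :* r :- (a :+ b) := con 1ℚ :* ((r :- a) :+ (r :- b) :- μ :* r))
    refl (seq μ n) (seq (v (spoke 0F i)) n) (seq (v (spoke 1F i)) n) (seq (v (page i)) n)

  spoke-sum : ∀ y → β k μ * S y ≈ κ * (S y + s) + R
  spoke-sum y = begin
    β k μ * S y                                  ≈⟨ *-distribˡ-sum (β k μ) (v ∘ spoke y) ⟩
    sum (λ i → β k μ * v (spoke y i))            ≈⟨ sum-cong-≋ (spoke-equation y) ⟩
    sum (λ i → (S y + s) + v (page i))           ≈⟨ ∑-distrib-+ (λ _ → S y + s) (v ∘ page) ⟩
    sum {k} (λ _ → S y + s) + R                  ≈⟨ +-cong (sum-const k (S y + s)) ≈-refl ⟩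
    κ * (S y + s) + R                            ∎

  page-sum : α μ * R ≈ S 0F + S 1F
  page-sum = begin
    α μ * R                                          ≈⟨ *-distribˡ-sum (α μ) (v ∘ page) ⟩
    sum (λ i → α μ * v (page i))                     ≈⟨ sum-cong-≋ page-equation ⟩
    sum (λ i → v (spoke 0F i) + v (spoke 1F i))      ≈⟨ ∑-distrib-+ (v ∘ spoke 0F) (v ∘ spoke 1F) ⟩
    S 0F + S 1F                                      ∎

  -- Write `A`, `B` for the two values of `S`. Since `β - k = α`, the spoke sums add up to
  -- `α (A + B) = 2 k s + 2 R`. Eliminating `R` by `α R = A + B`, and then `A + B` by the spine
  -- equation `A + B = (2 k - μ) s`, leaves `((2 - α²) (2 k - μ) + 2 k α) s = 0`, and the
  -- coefficient equals `μ Q`. The multipliers given to `linear` record this elimination.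
  spine-annihilated : μ * Q k μ * s ≈ 0ℝ
  spine-annihilated = linear
    ((fromℕ 2 - α μ * α μ) ⊗ eigen spine ⊕ - α μ ⊗ spoke-sum 0F ⊕ - α μ ⊗ spoke-sum 1F ⊕ - fromℕ 2 ⊗ page-sum)
    λ n → solve 6
      (λ κ μ s A B R → μ :* Q′ κ μ :* s :- con 0ℚ :=
        (lit 2 :- α′ μ :* α′ μ) :* ((κ :* s :- A) :+ (κ :* s :- B) :- μ :* s) :+
        (:- α′ μ) :* (β′ κ μ :* A :- (κ :* (A :+ s) :+ R)) :+
        (:- α′ μ) :* (β′ κ μ :* B :- (κ :* (B :+ s) :+ R)) :+
        (:- lit 2) :* (α′ μ :* R :- (A :+ B)))
      refl (ι k) (seq μ n) (seq s n) (seq (S 0F) n) (seq (S 1F) n) (seq R n)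

  eigenvector-vanishes : α μ ≉ 0ℝ → β k μ ≉ 0ℝ → D k μ ≉ 0ℝ → s ≈ 0ℝ → ∀ e → v e ≈ 0ℝ
  eigenvector-vanishes α≉0 β≉0 D≉0 s≈0 = vanishes
    where
    S-difference : S 0F - S 1F ≈ 0ℝ
    -- Subtracting the two spoke sums cancels `s` and `R`, and `β - k = α`.
    S-difference = ≉0-cancel α≉0 (linear (1ℝ ⊗ spoke-sum 0F ⊕ - 1ℝ ⊗ spoke-sum 1F) λ n → solve 6
      (λ κ μ s A B R → α′ μ :* (A :- B) :- con 0ℚ :=
        con 1ℚ :* (β′ κ μ :* A :- (κ :* (A :+ s) :+ R)) :+
        (:- con 1ℚ) :* (β′ κ μ :* B :- (κ :* (B :+ s) :+ R)))
      refl (ι k) (seq μ n) (seq s n) (seq (S 0F) n) (seq (S 1F) n) (seq R n))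

    S-sum : S 0F + S 1F ≈ 0ℝ
    S-sum = linear (- 1ℝ ⊗ eigen spine ⊕ (fromℕ 2 * κ - μ) ⊗ s≈0) λ n → solve 5
      (λ κ μ s A B → A :+ B :- con 0ℚ :=
        (:- con 1ℚ) :* ((κ :* s :- A) :+ (κ :* s :- B) :- μ :* s) :+
        (lit 2 :* κ :- μ) :* (s :- con 0ℚ))
      refl (ι k) (seq μ n) (seq s n) (seq (S 0F) n) (seq (S 1F) n)

    S≈0 : ∀ y → S y ≈ 0ℝ
    S≈0 0F = linear (fromℚ ½ ⊗ S-sum ⊕ fromℚ ½ ⊗ S-difference) λ n → solve 2
      (λ A B → A :- con 0ℚ := con ½ :* (A :+ B :- con 0ℚ) :+ con ½ :* (A :- B :- con 0ℚ))
      refl (seq (S 0F) n) (seq (S 1F) n)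
    S≈0 1F = linear (fromℚ ½ ⊗ S-sum ⊕ - fromℚ ½ ⊗ S-difference) λ n → solve 2
      (λ A B → B :- con 0ℚ := con ½ :* (A :+ B :- con 0ℚ) :+ (:- con ½) :* (A :- B :- con 0ℚ))
      refl (seq (S 0F) n) (seq (S 1F) n)

    page≈0 : ∀ i → v (page i) ≈ 0ℝ
    -- `β` times the page equation is `α β r_i = β (a_i + b_i) = A + B + 2 s + 2 r_i`, hence `D r_i
    -- = A + B + 2 s = 0`.
    page≈0 i = ≉0-cancel D≉0 (linear
      (β k μ ⊗ page-equation i ⊕ 1ℝ ⊗ spoke-equation 0F i ⊕ 1ℝ ⊗ spoke-equation 1F i ⊕
        1ℝ ⊗ S-sum ⊕ fromℕ 2 ⊗ s≈0)
      λ n → solve 8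
        (λ κ μ s A B a b r → D′ κ μ :* r :- con 0ℚ :=
          β′ κ μ :* (α′ μ :* r :- (a :+ b)) :+ con 1ℚ :* (β′ κ μ :* a :- (A :+ s :+ r)) :+
          con 1ℚ :* (β′ κ μ :* b :- (B :+ s :+ r)) :+
          con 1ℚ :* (A :+ B :- con 0ℚ) :+ lit 2 :* (s :- con 0ℚ))
        refl (ι k) (seq μ n) (seq s n) (seq (S 0F) n) (seq (S 1F) n)
          (seq (v (spoke 0F i)) n) (seq (v (spoke 1F i)) n) (seq (v (page i)) n))

    vanishes : ∀ e → v e ≈ 0ℝ
    vanishes spine       = s≈0
    vanishes (page i)    = page≈0 i
    vanishes (spoke y i) = ≉0-cancel β≉0
      (≈-trans (spoke-equation y i) (S≈0 y ⊕ s≈0 ⊕ page≈0 i))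

-- Invariance properties of the action

InEigenspaceₑ : ∀ {k} → ℝ → (Edge k → ℝ) → Set
InEigenspaceₑ μ v = ∀ e → action v e ≈ μ * v e

difference-cong : ∀ {x x′ y y′} → x ≈ x′ → y ≈ y′ → x - y ≈ x′ - y′
difference-cong x≈x′ y≈y′ = +-cong x≈x′ (-‿cong y≈y′)

action-cong : ∀ {k} {u v : Edge k → ℝ} → (∀ e → u e ≈ v e) → ∀ e → action u e ≈ action v e
action-cong {k} {u} {v} u≈v = λ
  { spine       → +-cong (remote spine 0F) (remote spine 1F)
  ; (spoke y i) → +-cong (+-cong (local (spoke y i) spine) (remote (spoke y i) y))
                         (local (spoke y i) (page i))
  ; (page i)    → +-cong (local (page i) (spoke 0F i)) (local (page i) (spoke 1F i)) }
  where
  local : ∀ e f → u e - u f ≈ v e - v f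
  local e f = difference-cong (u≈v e) (u≈v f)

  remote : ∀ e y → fromℕ k * u e - sum (u ∘ spoke y) ≈ fromℕ k * v e - sum (v ∘ spoke y)
  remote e y = difference-cong (*-cong ≈-refl (u≈v e)) (sum-cong-≋ (u≈v ∘ spoke y))

-- Only differences of values enter the action. This puts the constants in the kernel and allows a
-- kernel vector to be normalised to zero on the spine.
action-translate : ∀ {k} (v : Edge k → ℝ) c e → action (λ f → v f - c) e ≈ action v e
action-translate {k} v c = λ
  { spine       → +-cong (remote spine 0F) (remote spine 1F)
  ; (spoke y i) → +-cong (+-cong (local (spoke y i) spine) (remote (spoke y i) y))
                         (local (spoke y i) (page i))
  ; (page i)    → +-cong (local (page i) (spoke 0F i)) (local (page i) (spoke 1F i)) }
  where
  local : ∀ e f → (v e - c) - (v f - c) ≈ v e - v f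
  local e f = pointwise λ n → solve 3 (λ x y c → (x :- c) :- (y :- c) := x :- y)
    refl (seq (v e) n) (seq (v f) n) (seq c n)

  translated : ∀ y → sum (λ i → v (spoke y i) - c) ≈ sum (v ∘ spoke y) + fromℕ k * - c
  translated y = ≈-trans (∑-distrib-+ (v ∘ spoke y) (λ _ → - c)) (+-cong ≈-refl (sum-const k (- c)))

  remote : ∀ e y → fromℕ k * (v e - c) - sum (λ i → v (spoke y i) - c) ≈
                   fromℕ k * v e - sum (v ∘ spoke y)
  remote e y = linear (- 1ℝ ⊗ translated y) λ n → solve 5
    (λ κ x c S S′ → (κ :* (x :- c) :- S′) :- (κ :* x :- S) :=
      (:- con 1ℚ) :* (S′ :- (S :+ κ :* (:- c))))
    refl (ι k) (seq (v e) n) (seq c n) (seq (sum (v ∘ spoke y)) n)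
      (seq (sum (λ i → v (spoke y i) - c)) n)

-- Signs of the factors for nonpositive `μ`

module NonPositive (k : ℕ) {μ : ℝ} (-μ≥0 : NonNegative (- μ)) where

  private κ≥0 = fromℕ-nonNegative k

  α-positive : Positive (α μ)
  α-positive = positive-+ (fromℕ-positive 1) -μ≥0

  β-positive : Positive (β k μ)
  β-positive = positive-+ (positive-+ (fromℕ-positive 1) κ≥0) -μ≥0

  -- Expanded in powers of `- μ`, `D` has nonnegative coefficients and constant term `2 + 2 k`.
  D-positive : Positive (D k μ)
  D-positive = positive-resp
    (λ n → solve 2
      (λ κ μ → lit 2 :+ ((:- μ) :* (lit 4 :+ κ :+ (:- μ)) :+ lit 2 :* κ) := D′ κ μ)
      refl (ι k) (seq μ n))
    (positive-+ (fromℕ-positive 1)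
      (nonNegative-+
        (nonNegative-* -μ≥0 (nonNegative-+ (nonNegative-+ (fromℕ-nonNegative 4) κ≥0) -μ≥0))
        (nonNegative-* (fromℕ-nonNegative 2) κ≥0)))

  Q-positive : Positive (Q k μ)
  Q-positive = positive-+ D-positive (nonNegative-* κ≥0 (nonNegative-+ (fromℕ-nonNegative 4) -μ≥0))

-- The root `λ₂` of `D` and the factors below it

σ λ₂ : ℕ → ℝ
σ k  = √ (k ℕ.* k ℕ.+ 8)
λ₂ k = (fromℕ 4 + fromℕ k - σ k) * fromℚ ½

λ₂′ : ∀ {m} → Polynomial m → Polynomial m → Polynomial m
λ₂′ κ σ = (lit 4 :+ κ :- σ) :* con ½

σ-square : ∀ k → σ k * σ k ≈ fromℕ k * fromℕ k + fromℕ 8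
σ-square k = ≈-trans (√-square (k ℕ.* k ℕ.+ 8))
  (≈-trans (fromℕ-+ (k ℕ.* k) 8) (+-cong (fromℕ-* k k) ≈-refl))

½-nonNegative : NonNegative (fromℚ ½)
½-nonNegative = nonNegative 0 λ _ _ → ℚ.nonNegative⁻¹ ½

-- In `μ`, `D` is the quadratic `μ² - (4 + k) μ + 2 + 2 k` of discriminant `k² + 8`, with roots `λ₂`
-- and `λ₂ + σ`. The two sides differ by a quarter of `σ² - (k² + 8)`.
D-factored : ∀ k μ → D k μ ≈ (λ₂ k - μ) * ((λ₂ k - μ) + σ k)
D-factored k μ = linear ((fromℚ ½ * fromℚ ½) ⊗ σ-square k) λ n → solve 3
  (λ κ μ σ → D′ κ μ :- (λ₂′ κ σ :- μ) :* ((λ₂′ κ σ :- μ) :+ σ) :=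
    con ½ :* con ½ :* (σ :* σ :- (κ :* κ :+ lit 8)))
  refl (ι k) (seq μ n) (seq (σ k) n)

D-λ₂ : ∀ k → D k (λ₂ k) ≈ 0ℝ
D-λ₂ k = ≈-trans (D-factored k (λ₂ k)) (pointwise λ n → solve 2
  (λ l σ → (l :- l) :* ((l :- l) :+ σ) := con 0ℚ) refl (seq (λ₂ k) n) (seq (σ k) n))

-- `D` has the value `2 + 2 k` at zero, so zero is not a root of it.
λ₂≉0 : ∀ k → λ₂ k ≉ 0ℝ
λ₂≉0 k λ₂≈0 = positive⇒≉0
  (positive-+ (fromℕ-positive 1) (nonNegative-* (fromℕ-nonNegative 2) (fromℕ-nonNegative k)))
  (linear (1ℝ ⊗ D-λ₂ k ⊕ (fromℕ 4 + fromℕ k - λ₂ k) ⊗ λ₂≈0) λ n → solve 2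
    (λ κ l → lit 2 :+ lit 2 :* κ :- con 0ℚ :=
      con 1ℚ :* (D′ κ l :- con 0ℚ) :+ (lit 4 :+ κ :- l) :* (l :- con 0ℚ))
    refl (ι k) (seq (λ₂ k) n))

module BelowSecond (k : ℕ) {μ : ℝ} (μ<λ₂ : μ < λ₂ k) where

  private
    κ t : ℝ
    κ = fromℕ k
    t = λ₂ k - μ

    t>0 : Positive t
    t>0 = <⇒positive μ<λ₂

    product>0 : Positive (t * (t + σ k))
    product>0 = positive-* t>0 (positive-+ t>0 (√-nonNegative (k ℕ.* k ℕ.+ 8)))

  -- `β` vanishes at `2 + k`, which exceeds `λ₂` by `(k + σ) / 2`.
  β-positive : Positive (β k μ)
  β-positive = positive-resp
    (λ n → solve 3 (λ κ μ σ → (λ₂′ κ σ :- μ) :+ con ½ :* (κ :+ σ) := β′ κ μ)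
      refl (ι k) (seq μ n) (seq (σ k) n))
    (positive-+ t>0 (nonNegative-* ½-nonNegative
      (nonNegative-+ (fromℕ-nonNegative k) (√-nonNegative (k ℕ.* k ℕ.+ 8)))))

  D≉0 : D k μ ≉ 0ℝ
  D≉0 = ≉0-resp (D-factored k μ) (positive⇒≉0 product>0)

  -- `α β = D + 2` is positive here.
  α≉0 : α μ ≉ 0ℝ
  α≉0 α≈0 = positive⇒≉0 (positive-+ product>0 (fromℕ-nonNegative 2))
    (linear (β k μ ⊗ α≈0 ⊕ - 1ℝ ⊗ D-factored k μ) λ n → solve 3
      (λ κ μ p → p :+ lit 2 :- con 0ℚ :=
        β′ κ μ :* (α′ μ :- con 0ℚ) :+ (:- con 1ℚ) :* (D′ κ μ :- p))
      refl (ι k) (seq μ n) (seq (t * (t + σ k)) n))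

  -- Q β = (D + 2 k) β + k (D + 2), since α β = D + 2.
  Q≉0 : Q k μ ≉ 0ℝ
  Q≉0 Q≈0 = positive⇒≉0
    (positive-+
      (positive-* (positive-+ product>0 (nonNegative-* (fromℕ-nonNegative 2) (fromℕ-nonNegative k)))
        β-positive)
      (nonNegative-* (fromℕ-nonNegative k)
        (nonNegative-+ (positive⇒nonNegative product>0) (fromℕ-nonNegative 2))))
    (linear (β k μ ⊗ Q≈0 ⊕ - (β k μ + κ) ⊗ D-factored k μ) λ n → solve 3
      (λ κ μ p → (p :+ lit 2 :* κ) :* β′ κ μ :+ κ :* (p :+ lit 2) :- con 0ℚ :=
        β′ κ μ :* (Q′ κ μ :- con 0ℚ) :+ (:- (β′ κ μ :+ κ)) :* (D′ κ μ :- p))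
      refl (ι k) (seq μ n) (seq (t * (t + σ k)) n))

-- Explicit eigenvectors

constant-eigen : ∀ {k} → InEigenspaceₑ {k} 0ℝ (λ _ → 1ℝ)
constant-eigen {k} e = ≈-trans (≈-sym (action-translate (λ _ → 1ℝ) 1ℝ e))
  (≈-trans (action-cong (λ _ → +-inverseʳ 1ℝ) e) (≈-trans (action-zero e) (≈-sym (*-identityʳ 0ℝ))))
  where
  action-zero : ∀ e → action {k} (λ _ → 0ℝ) e ≈ 0ℝ
  action-zero spine = linear (- fromℕ 2 ⊗ sum-replicate-zero k) λ n → solve 2
    (λ κ S → (κ :* con 0ℚ :- S) :+ (κ :* con 0ℚ :- S) :- con 0ℚ := (:- lit 2) :* (S :- con 0ℚ))
    refl (ι k) (seq (sum {k} (λ _ → 0ℝ)) n)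
  action-zero (spoke y i) = linear (- 1ℝ ⊗ sum-replicate-zero k) λ n → solve 2
    (λ κ S → (con 0ℚ :- con 0ℚ) :+ (κ :* con 0ℚ :- S) :+ (con 0ℚ :- con 0ℚ) :- con 0ℚ :=
      (:- con 1ℚ) :* (S :- con 0ℚ))
    refl (ι k) (seq (sum {k} (λ _ → 0ℝ)) n)
  action-zero (page i) = pointwise λ _ → refl

-- With these values the page equation holds identically. When the entries of `c` sum to zero, the
-- spoke equation becomes `α β c_i = 2 c_i`, that is `D c_i = 0`, and so holds at `λ₂`.
modulated : ∀ {k} → ℝ → Vector ℝ k → Edge k → ℝ
modulated μ c spine       = 0ℝ
modulated μ c (spoke _ i) = α μ * c i
modulated μ c (page i)    = fromℕ 2 * c i

modulated-eigen : ∀ {k} c → sum c ≈ 0ℝ → InEigenspaceₑ {k} (λ₂ k) (modulated (λ₂ k) c)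
modulated-eigen {k} c Σc≈0 = eigen
  where
  μ S : ℝ
  μ = λ₂ k
  S = sum (λ i → α μ * c i)

  S≈0 : S ≈ 0ℝ
  S≈0 = ≈-trans (≈-sym (*-distribˡ-sum (α μ) c)) (linear (α μ ⊗ Σc≈0) λ n → solve 2
    (λ a s → a :* s :- con 0ℚ := a :* (s :- con 0ℚ)) refl (seq (α μ) n) (seq (sum c) n))

  eigen : ∀ e → action (modulated μ c) e ≈ μ * modulated μ c e
  eigen spine = linear (- fromℕ 2 ⊗ S≈0) λ n → solve 3
    (λ κ μ S → (κ :* con 0ℚ :- S) :+ (κ :* con 0ℚ :- S) :- μ :* con 0ℚ :=
      (:- lit 2) :* (S :- con 0ℚ))
    refl (ι k) (seq μ n) (seq S n)
  eigen (spoke _ i) = linear (c i ⊗ D-λ₂ k ⊕ - 1ℝ ⊗ S≈0) λ n → solve 4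
    (λ κ μ S c → (α′ μ :* c :- con 0ℚ) :+ (κ :* (α′ μ :* c) :- S) :+ (α′ μ :* c :- lit 2 :* c) :-
        μ :* (α′ μ :* c) :=
      c :* (D′ κ μ :- con 0ℚ) :+ (:- con 1ℚ) :* (S :- con 0ℚ))
    refl (ι k) (seq μ n) (seq S n) (seq (c i) n)
  eigen (page i) = pointwise λ n → solve 2
    (λ μ c → (lit 2 :* c :- α′ μ :* c) :+ (lit 2 :* c :- α′ μ :* c) := μ :* (lit 2 :* c))
    refl (seq μ n) (seq (c i) n)

-- Two pages carry `1` and `- 1`. The entry `1` later shows that the eigenvector built from `c` is
-- nonzero.
balanced : ∀ {k} → 2 ℕ.≤ k → ∃[ c ] (sum {k} c ≈ 0ℝ × ∃[ i ] c i ≈ 1ℝ)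
balanced {suc (suc m)} (ℕ.s≤s (ℕ.s≤s _)) = c , Σc≈0 , zero , ≈-refl
  where
  c : Vector ℝ (suc (suc m))
  c zero          = 1ℝ
  c (suc zero)    = - 1ℝ
  c (suc (suc _)) = 0ℝ

  Σc≈0 : sum c ≈ 0ℝ
  Σc≈0 = linear (1ℝ ⊗ sum-replicate-zero m) λ n → solve 1
    (λ z → con 1ℚ :+ ((:- con 1ℚ) :+ z) :- con 0ℚ := con 1ℚ :* (z :- con 0ℚ))
    refl (seq (sum {m} (λ _ → 0ℝ)) n)

-- The two smallest eigenvalues

-- Any matrix with this action on labelled coordinates, rather than the Laplacian itself, so
-- that conversion checking cannot unfold the line graph.
module Spectrum {k n : ℕ} (at : Edge k → Fin n) (label : Fin n → Edge k)
  (label-at : ∀ e → label (at e) ≡ e) (at-label : ∀ x → at (label x) ≡ x)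
  (M : Matrix n) (M-action : ∀ w e → (M *ᵥ w) (at e) ≈ action (w ∘ at) e) where

  labels-cover : ∀ {u w : Vector ℝ n} →
    (∀ e → u (at e) ≈ w (at e)) → u ≋ w
  labels-cover {u} {w} u≈w x = subst (λ x → u x ≈ w x) (at-label x) (u≈w (label x))

  labelled : ∀ {μ w} → InEigenspace M μ w → InEigenspaceₑ {k} μ (w ∘ at)
  labelled {μ} {w} Mw≈μw e = ≈-trans (≈-sym (M-action w e)) (Mw≈μw (at e))

  unlabelled : ∀ {μ w} → InEigenspaceₑ {k} μ (w ∘ at) → InEigenspace M μ w
  unlabelled {μ} {w} eigen = labels-cover {M *ᵥ w} {μ · w} λ e → ≈-trans (M-action w e) (eigen e)

  -- Cancelling `μ` and `Q` in `spine-annihilated` makes the eigenvector vanish on the spine, hence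
  -- everywhere. The conclusion is a negation because a vanishing product of reals does not reveal
  -- constructively which factor vanishes.
  eigenvalue-root : ∀ {μ} → Eigenvalue M μ →
    μ ≉ 0ℝ → α μ ≉ 0ℝ → β k μ ≉ 0ℝ → D k μ ≉ 0ℝ → ¬ (Q k μ ≉ 0ℝ)
  eigenvalue-root {μ} (w , w≉0 , Mw≈μw) μ≉0 α≉0 β≉0 D≉0 Q≉0 =
    w≉0 (labels-cover (eigenvector-vanishes eigen α≉0 β≉0 D≉0 s≈0))
    where
    eigen : InEigenspaceₑ μ (w ∘ at)
    eigen = labelled Mw≈μw

    s≈0 : w (at spine) ≈ 0ℝ
    s≈0 = ≉0-cancel Q≉0 (≉0-cancel μ≉0
      (≈-trans (≈-sym (*-assoc μ (Q k μ) (w (at spine)))) (spine-annihilated eigen)))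

  -- At `μ = 0` the equation `spine-annihilated` says nothing about the spine. Subtracting the spine
  -- value instead gives a kernel vector that is zero there, and `α`, `β`, `D` are positive at zero.
  kernel-constant : ∀ {w} → InEigenspace M 0ℝ w → ∀ x → w x ≈ w (at spine)
  kernel-constant {w} Mw≈0 = labels-cover {w} {λ _ → s} λ e →
    linear (1ℝ ⊗ vanishes e) λ m → solve 2 (λ x s → x :- s := con 1ℚ :* (x :- s :- con 0ℚ))
      refl (seq (w (at e)) m) (seq s m)
    where
    open NonPositive k {0ℝ} (nonNegative 0 λ _ _ → ℚ.≤-refl)
    s = w (at spine)

    eigen : InEigenspaceₑ {k} 0ℝ (λ e → w (at e) - s)
    eigen e = ≈-trans (action-translate (w ∘ at) s e) (≈-trans (labelled Mw≈0 e)
      (pointwise λ m → solve 2 (λ x s → con 0ℚ :* x := con 0ℚ :* (x :- s))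
        refl (seq (w (at e)) m) (seq s m)))

    vanishes : ∀ e → w (at e) - s ≈ 0ℝ
    vanishes = eigenvector-vanishes eigen (positive⇒≉0 α-positive) (positive⇒≉0 β-positive)
      (positive⇒≉0 D-positive) (+-inverseʳ s)

  zero-eigenvalue : Eigenvalue M 0ℝ
  zero-eigenvalue = (λ _ → 1ℝ) , (λ 1≈0 → positive⇒≉0 (fromℕ-positive 0) (1≈0 (at spine)))
    , unlabelled constant-eigen

  zero-least : ∀ μ → Eigenvalue M μ → 0ℝ ≤ μ
  zero-least μ ev μ<0 = eigenvalue-root ev
    (λ μ≈0 → positive⇒≉0 -μ>0 (≈-trans (-‿cong μ≈0) (pointwise λ _ → refl)))
    (positive⇒≉0 α-positive) (positive⇒≉0 β-positive) (positive⇒≉0 D-positive) (positive⇒≉0 Q-positive)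
    where
    -μ>0 : Positive (- μ)
    -μ>0 = positive-resp (λ m → ℚ.+-identityˡ (ℚ.- seq μ m)) (<⇒positive μ<0)

    open NonPositive k {μ} (positive⇒nonNegative -μ>0)

  zero-simple : Multiplicity M 0ℝ 1
  zero-simple = record
    { basis       = λ _ _ → 1ℝ
    ; eigenvector = λ _ → unlabelled constant-eigen
    ; independent = λ { c c·1≈0 zero → ≈-trans (≈-sym (single (c zero))) (c·1≈0 (at spine)) }
    ; spanning    = λ w Mw≈0 → (λ _ → w (at spine)) , λ x →
                      ≈-trans (kernel-constant Mw≈0 x) (≈-sym (single (w (at spine))))
    }
    where
    single : ∀ x → x * 1ℝ + 0ℝ ≈ x
    single x = pointwise λ m → solve 1 (λ x → x :* con 1ℚ :+ con 0ℚ := x) refl (seq x m)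

  λ₂-eigenvalue : 2 ℕ.≤ k → Eigenvalue M (λ₂ k)
  λ₂-eigenvalue 2≤k with c , Σc≈0 , i , cᵢ≈1 ← balanced 2≤k = w , w≉0 , unlabelled eigen
    where
    v : Edge k → ℝ
    v = modulated (λ₂ k) c

    w : Vector ℝ n
    w = v ∘ label

    w≈v : ∀ e → w (at e) ≈ v e
    w≈v e = ≡⇒≈ (cong v (label-at e))

    w≉0 : ¬ (w ≋ 0ᵥ)
    -- The entry of `w` at `page i` is `2 c_i`, which is `2`.
    w≉0 w≈0 = positive⇒≉0 (fromℕ-positive 1)
      (linear (- fromℕ 2 ⊗ cᵢ≈1 ⊕ 1ℝ ⊗ ≈-trans (≈-sym (w≈v (page i))) (w≈0 (at (page i))))
        λ m → solve 1 (λ c → lit 2 :- con 0ℚ :=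
          (:- lit 2) :* (c :- con 1ℚ) :+ con 1ℚ :* (lit 2 :* c :- con 0ℚ)) refl (seq (c i) m))

    eigen : InEigenspaceₑ {k} (λ₂ k) (w ∘ at)
    eigen e = ≈-trans (action-cong w≈v e)
      (≈-trans (modulated-eigen c Σc≈0 e) (*-cong ≈-refl (≈-sym (w≈v e))))

  λ₂-least : ∀ μ → Eigenvalue M μ × μ ≉ 0ℝ → λ₂ k ≤ μ
  λ₂-least μ (ev , μ≉0) μ<λ₂ = eigenvalue-root ev μ≉0 α≉0 (positive⇒≉0 β-positive) D≉0 Q≉0
    where open BelowSecond k μ<λ₂

  second-smallest : 2 ℕ.≤ k → SecondSmallestEigenvalue M (λ₂ k)
  second-smallest 2≤k = simple (zero-eigenvalue , zero-least) zero-simple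
    ((λ₂-eigenvalue 2≤k , λ₂≉0 k) , λ₂-least)

theorem16 : ∀ (k : ℕ) → 3 ℕ.≤ k →
    AlgebraicConnectivity (lineGraph (book k))
    ((fromℕ 4 + fromℕ k - √ (k ℕ.* k ℕ.+ 8)) * fromℚ ½)
theorem16 k 3≤k = Spectrum.second-smallest {k}
  (position {k}) (edgeAt {k}) (edgeAt-position {k}) (position-edgeAt {k})
  (laplacian (lineGraph (book k))) (laplacian-position {k})
  (ℕ.≤-trans (ℕ.n≤1+n 2) 3≤k)
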